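{- For every $\beta$ with $0<\beta<1/4$ there exists $d_0=d_0(\beta)$ such that for every integer $d\ge d_0$ and every $d$-regular graph $G$ on $n$ vertices with $d^{1+\beta}\ge n$, \[ s(G) < \frac{n}{d}+28. \]
   Context: All graphs are finite and simple. For a graph $G$ and a positive integer $k$, an edge-weighting $f:E(G)\to\{1,\dots,k\}$ is $k$-irregular if the weighted degrees $f^V(v)=\sum_{u:\{u,v\}\in E(G)} f(\{u,v\})$ are pairwise distinct over $v\in V(G)$. The irregularity strength $s(G)$ is the least $k$ for which a $k$-irregular edge-weighting exists ($s(G)=\infty$ if none exists). -}

module Defs where

open import Data.Nat using (ℕ; _≤_; _+_)
open import Data.Bool using (Bool; true; false; if_then_else_)
open import Data.Fin using (Fin)
open import Data.List using (tabulate)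
open import Data.Nat.ListAction using (sum)
open import Data.Product using (Σ; _×_)
open import Relation.Binary.PropositionalEquality using (_≡_)

record Graph (n : ℕ) : Set where
  field
    adj    : Fin n → Fin n → Bool
    sym    : ∀ u v → adj u v ≡ adj v u
    irrefl : ∀ v → adj v v ≡ false
open Graph public

deg : ∀ {n} → Graph n → Fin n → ℕ
deg {n} G v = sum (tabulate {n = n} (λ u → if adj G v u then 1 else 0))

Regular : ∀ {n} → Graph n → ℕ → Set
Regular G d = ∀ v → deg G v ≡ d

-- An edge weighting with values in {1,…,k}: a weight for each edge {u,v}
-- (given as a function symmetric on edges; values on non-edges are irrelevant).
record Weighting {n : ℕ} (G : Graph n) (k : ℕ) : Set where
  field
    w      : Fin n → Fin n → ℕ
    w-sym  : ∀ u v → adj G u v ≡ true → w u v ≡ w v u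
    w-rng  : ∀ u v → adj G u v ≡ true → (1 ≤ w u v) × (w u v ≤ k)
open Weighting public

wdeg : ∀ {n} {G : Graph n} {k} → Weighting G k → Fin n → ℕ
wdeg {n} {G} f v = sum (tabulate {n = n} (λ u → if adj G v u then w f v u else 0))

Irregular : ∀ {n} {G : Graph n} {k} → Weighting G k → Set
Irregular {n} f = ∀ (u v : Fin n) → wdeg f u ≡ wdeg f v → u ≡ v

HasIrregularWeighting : ∀ {n} → Graph n → ℕ → Set
HasIrregularWeighting G k = Σ (Weighting G k) Irregular

{-# OPTIONS --safe #-}
module Submission where

-- Write D for a discrepancy of order √d log d.  A derandomised Chernoff argument colours the
-- vertices with d colours so that every neighbourhood contains t ± D vertices of colour < t,
-- for every t.  Put K = ⌊n/d⌋ + 1 and k = K + 26.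
--
-- Call B the vertices of the lowest colours (all but o(d) of them) and give an edge inside B
-- weight 1 + K or 1 according to whether the two colours add up to at least |colours of B|.
-- A vertex of B then has weighted degree K · (its colour) + constant ± O(k D), i.e. its rank in
-- the colour order up to that error.  The remaining vertices form P, Q and R, cut into
-- levels; an edge from B to a level gets a weight h that increases with the level, so distinct
-- levels, and B, end up with disjoint ranges of weighted degrees.
--
-- The errors are then repaired in turn.  Each vertex of B adds 0 or 1 on its edges to P to
-- reach exactly its slot.  Each vertex of P adds at most M ≈ K/3 on its edges to Q to reach a
-- prescribed residue, for which both values w and w + M are reserved.  Each vertex of Q
-- corrects its residue modulo M on its edges to R.  Finally Q and R adjust the quotient by M
-- by moving vertices of P between their two reserved values.  All this works as soon as
-- k² D = o(d), which is the condition β < 1/4.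

open import Defs using (Graph; adj; deg; Regular; Weighting; wdeg; Irregular; HasIrregularWeighting)
open import Data.Bool using (Bool; true; false; if_then_else_; _∧_; not; T)
open import Data.Empty using (⊥-elim)
open import Data.Fin using (Fin; zero; suc; toℕ; combine; remQuot; fromℕ<)
open import Data.Fin.Properties using (toℕ<n; toℕ-fromℕ<; toℕ-injective; remQuot-combine)
open import Data.List using (tabulate)
open import Data.Nat
open import Data.Nat.DivMod
open import Data.Nat.ListAction using (sum)
open import Data.Nat.Properties
open import Data.Nat.Tactic.RingSolver using (solve-∀)
open import Data.Product using (Σ; _×_; _,_; proj₁; proj₂)
open import Data.Sum using (inj₁; inj₂)
open import Data.Unit using (tt)
open import Relation.Binary using (tri<; tri≈; tri>)
open import Relation.Binary.PropositionalEquality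
open import Relation.Nullary using (yes; no; ¬_)

-- Finite sums and choices below average

-- The obstacle is circularity: a vertex is corrected on edges whose other end is not settled yet,
-- so the last vertices have nobody left to take their error. Toggling resolves this. When vertices
-- of Q and R replace the bits of their neighbours in P, the changes telescope: each vertex of P
-- knows its total in advance up to one final bit times M. The two reserved values pay for that bit,
-- so P can be settled first.
--
-- The constants balance three demands. A level of ℓ colours holds about K ℓ consecutive ranks; with
-- M near K/3, chosen since an edge between P and Q may carry M + 2 M, telling them apart takes z
-- near 3 ℓ quotients, doubled for the two values. This needs about 6 ℓ neighbours, hence 7 levels
-- for P and 7 for Q. The unit corrections of B need order k D neighbours in P, which fixes ℓ.
-- Vertices whose weights towards B differ by 1 are apart by d, up to k for each of the order k D
-- neighbours outside B; hence k² D = o(d). Climbing 2 per level of P and 1 per level of Q above K +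
-- 5 ends at K + 26.

∑ : ∀ {n} → (Fin n → ℕ) → ℕ
∑ f = sum (tabulate f)

∏ : ∀ {n} → (Fin n → ℕ) → ℕ
∏ {zero}  f = 1
∏ {suc n} f = f zero * ∏ (λ i → f (suc i))

𝟙 : Bool → ℕ
𝟙 b = if b then 1 else 0

∑-cong : ∀ {n} {f g : Fin n → ℕ} → (∀ i → f i ≡ g i) → ∑ f ≡ ∑ g
∑-cong {zero}  h = refl
∑-cong {suc n} h = cong₂ _+_ (h zero) (∑-cong (λ i → h (suc i)))

∑-mono : ∀ {n} {f g : Fin n → ℕ} → (∀ i → f i ≤ g i) → ∑ f ≤ ∑ g
∑-mono {zero}  h = z≤n
∑-mono {suc n} h = +-mono-≤ (h zero) (∑-mono (λ i → h (suc i)))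

+-interchange : ∀ a b c d → (a + b) + (c + d) ≡ (a + c) + (b + d)
+-interchange = solve-∀

∑-distrib-+ : ∀ {n} (f g : Fin n → ℕ) → ∑ (λ i → f i + g i) ≡ ∑ f + ∑ g
∑-distrib-+ {zero}  f g = refl
∑-distrib-+ {suc n} f g =
  trans (cong (f zero + g zero +_) (∑-distrib-+ (λ i → f (suc i)) (λ i → g (suc i))))
        (+-interchange (f zero) (g zero) _ _)

∑-distribˡ-* : ∀ {n} a (f : Fin n → ℕ) → ∑ (λ i → a * f i) ≡ a * ∑ f
∑-distribˡ-* {zero}  a f = sym (*-zeroʳ a)
∑-distribˡ-* {suc n} a f =
  trans (cong (a * f zero +_) (∑-distribˡ-* a (λ i → f (suc i))))
        (sym (*-distribˡ-+ a (f zero) _))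

∑-const : ∀ n a → ∑ {n} (λ _ → a) ≡ n * a
∑-const zero    a = refl
∑-const (suc n) a = cong (a +_) (∑-const n a)

∑-swap : ∀ {m n} (f : Fin m → Fin n → ℕ) →
         ∑ (λ i → ∑ (λ j → f i j)) ≡ ∑ (λ j → ∑ (λ i → f i j))
∑-swap {zero}  {n} f = sym (trans (∑-const n 0) (*-zeroʳ n))
∑-swap {suc m} f =
  trans (cong (∑ (f zero) +_) (∑-swap (λ i → f (suc i))))
        (sym (∑-distrib-+ (f zero) (λ j → ∑ (λ i → f (suc i) j))))

term≤∑ : ∀ {n} (f : Fin n → ℕ) i → f i ≤ ∑ f
term≤∑ f zero    = m≤m+n _ _
term≤∑ f (suc i) = ≤-trans (term≤∑ (λ j → f (suc j)) i) (m≤n+m _ _)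

∑-below-average : ∀ {m} (g : Fin m → ℕ) X → 0 < m → ∑ g ≤ m * X → Σ (Fin m) λ i → g i ≤ X
∑-below-average {suc m} g X _ le with g zero ≤? X
... | yes p = zero , p
∑-below-average {suc zero} g X _ le | no ¬p =
  ⊥-elim (¬p (≤-trans (m≤m+n _ _) (≤-trans le (≤-reflexive (*-identityˡ X)))))
∑-below-average {suc (suc m)} g X _ le | no ¬p
  with ∑-below-average (λ i → g (suc i)) X z<s
         (+-cancelˡ-≤ X _ _ (≤-trans (+-monoˡ-≤ _ (<⇒≤ (≰⇒> ¬p))) le))
... | i , q = suc i , q

-- The method of conditional expectations: coordinates are fixed one at a time, each at a colour
-- where the weighted sum is at most its average. The weights `ω` carry the factors fixed so far,
-- which is why they must be general for the induction.
choose-below-average :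
  ∀ {m d} n (N : ℕ) → 0 < d → (F : Fin m → Fin n → Fin d → ℕ) →
  (∀ j u → ∑ (F j u) ≤ d * N) → (ω : Fin m → ℕ) →
  Σ (Fin n → Fin d) λ c → ∑ (λ j → ω j * ∏ (λ u → F j u (c u))) ≤ ∑ ω * N ^ n
choose-below-average zero N 0<d F avg ω =
  (λ ()) , ≤-reflexive (trans (∑-cong (λ j → *-identityʳ (ω j))) (sym (*-identityʳ (∑ ω))))
choose-below-average {m} {d} (suc n) N 0<d F avg ω = c , bound
  where
  g : Fin d → ℕ
  g i = ∑ (λ j → ω j * F j zero i)
  ∑g≤ : ∑ g ≤ d * (∑ ω * N)
  ∑g≤ = begin
    ∑ g                                  ≡⟨ ∑-swap (λ i j → ω j * F j zero i) ⟩
    ∑ (λ j → ∑ (λ i → ω j * F j zero i)) ≡⟨ ∑-cong (λ j → ∑-distribˡ-* (ω j) (F j zero)) ⟩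
    ∑ (λ j → ω j * ∑ (F j zero))         ≤⟨ ∑-mono (λ j → *-monoʳ-≤ (ω j) (avg j zero)) ⟩
    ∑ (λ j → ω j * (d * N))              ≡⟨ ∑-cong (λ j → *-comm (ω j) (d * N)) ⟩
    ∑ (λ j → d * N * ω j)                ≡⟨ ∑-distribˡ-* (d * N) ω ⟩
    d * N * ∑ ω                          ≡⟨ *-assoc d N (∑ ω) ⟩
    d * (N * ∑ ω)                        ≡⟨ cong (d *_) (*-comm N (∑ ω)) ⟩
    d * (∑ ω * N)                        ∎
    where open ≤-Reasoning
  first : Σ (Fin d) λ i → g i ≤ ∑ ω * N
  first = ∑-below-average g (∑ ω * N) 0<d ∑g≤
  i₀ : Fin d
  i₀ = proj₁ first
  rest : Σ (Fin n → Fin d) λ c →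
         ∑ (λ j → ω j * F j zero i₀ * ∏ (λ u → F j (suc u) (c u))) ≤ g i₀ * N ^ n
  rest = choose-below-average n N 0<d (λ j u → F j (suc u)) (λ j u → avg j (suc u))
           (λ j → ω j * F j zero i₀)
  c : Fin (suc n) → Fin d
  c zero    = i₀
  c (suc u) = proj₁ rest u
  bound : ∑ (λ j → ω j * ∏ (λ u → F j u (c u))) ≤ ∑ ω * N ^ suc n
  bound = begin
    ∑ (λ j → ω j * ∏ (λ u → F j u (c u)))
      ≡⟨ ∑-cong (λ j → sym (*-assoc (ω j) _ _)) ⟩
    ∑ (λ j → ω j * F j zero i₀ * ∏ (λ u → F j (suc u) (c (suc u))))
      ≤⟨ proj₂ rest ⟩
    g i₀ * N ^ n        ≤⟨ *-monoˡ-≤ (N ^ n) (proj₂ first) ⟩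
    ∑ ω * N * N ^ n     ≡⟨ *-assoc (∑ ω) N (N ^ n) ⟩
    ∑ ω * (N * N ^ n)   ∎
    where open ≤-Reasoning

-- Turns a product over all vertices into powers counting the neighbours on each side of a
-- threshold. Non-neighbours contribute the neutral value `N`; the extra powers of `N` on both sides
-- replace division by it.
∏-three-valued : ∀ {n} (A B : Fin n → Bool) X Y N →
  X ^ ∑ (λ u → 𝟙 (A u ∧ B u)) * Y ^ ∑ (λ u → 𝟙 (A u ∧ not (B u))) * N ^ n
    ≡ ∏ (λ u → if A u then (if B u then X else Y) else N)
        * N ^ (∑ (λ u → 𝟙 (A u ∧ B u)) + ∑ (λ u → 𝟙 (A u ∧ not (B u))))
∏-three-valued {zero}  A B X Y N = refl
∏-three-valued {suc n} A B X Y N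
  with A zero | B zero | ∏-three-valued (λ u → A (suc u)) (λ u → B (suc u)) X Y N
... | false | _ | ih = trans (e (X ^ a) (Y ^ b) N (N ^ n)) (trans (cong (N *_) ih) (sym (*-assoc N _ _)))
  where
  a b : ℕ
  a = ∑ (λ u → 𝟙 (A (suc u) ∧ B (suc u)))
  b = ∑ (λ u → 𝟙 (A (suc u) ∧ not (B (suc u))))
  e : ∀ x y N z → x * y * (N * z) ≡ N * (x * y * z)
  e = solve-∀
... | true | true | ih =
    trans (e₁ X (X ^ a) (Y ^ b) N (N ^ n)) (trans (cong (X * N *_) ih) (e₂ X N P (N ^ (a + b))))
  where
  a b P : ℕ
  a = ∑ (λ u → 𝟙 (A (suc u) ∧ B (suc u)))
  b = ∑ (λ u → 𝟙 (A (suc u) ∧ not (B (suc u))))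
  P = ∏ (λ u → if A (suc u) then (if B (suc u) then X else Y) else N)
  e₁ : ∀ X x y N z → X * x * y * (N * z) ≡ X * N * (x * y * z)
  e₁ = solve-∀
  e₂ : ∀ X N p q → X * N * (p * q) ≡ X * p * (N * q)
  e₂ = solve-∀
... | true | false | ih =
    trans (e₁ Y (X ^ a) (Y ^ b) N (N ^ n))
      (trans (cong (Y * N *_) ih)
        (trans (e₂ Y N P (N ^ (a + b))) (cong (λ m → Y * P * N ^ m) (sym (+-suc a b)))))
  where
  a b P : ℕ
  a = ∑ (λ u → 𝟙 (A (suc u) ∧ B (suc u)))
  b = ∑ (λ u → 𝟙 (A (suc u) ∧ not (B (suc u))))
  P = ∏ (λ u → if A (suc u) then (if B (suc u) then X else Y) else N)
  e₁ : ∀ Y x y N z → x * (Y * y) * (N * z) ≡ Y * N * (x * y * z)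
  e₁ = solve-∀
  e₂ : ∀ X N p q → X * N * (p * q) ≡ X * p * (N * q)
  e₂ = solve-∀

∑-threshold : ∀ d t X Y → t ≤ d →
  ∑ {d} (λ i → if toℕ i <ᵇ t then X else Y) ≡ t * X + (d ∸ t) * Y
∑-threshold d zero X Y _ = ∑-const d Y
∑-threshold (suc d) (suc t) X Y (s≤s t≤d) =
  trans (cong (X +_) (∑-threshold d t X Y t≤d)) (sym (+-assoc X (t * X) _))

-- Exponential moments

-- The inequality 1 + k/N ≤ (1 + 1/N)^k with denominators cleared.
bernoulli : ∀ N k → N ^ k * (N + k) ≤ N * (1 + N) ^ k
bernoulli N zero = ≤-reflexive (e N)
  where
  e : ∀ N → 1 * (N + 0) ≡ N * 1
  e = solve-∀
bernoulli N (suc k) = begin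
  N * N ^ k * (N + suc k)              ≤⟨ m≤m+n _ (N ^ k * k) ⟩
  N * N ^ k * (N + suc k) + N ^ k * k  ≡⟨ e₁ N (N ^ k) k ⟩
  (1 + N) * (N ^ k * (N + k))          ≤⟨ *-monoʳ-≤ (1 + N) (bernoulli N k) ⟩
  (1 + N) * (N * (1 + N) ^ k)          ≡⟨ e₂ N ((1 + N) ^ k) ⟩
  N * ((1 + N) * (1 + N) ^ k)          ∎
  where
  open ≤-Reasoning
  e₁ : ∀ N p k → N * p * (N + suc k) + p * k ≡ (1 + N) * (p * (N + k))
  e₁ = solve-∀
  e₂ : ∀ N p → (1 + N) * (N * p) ≡ N * ((1 + N) * p)
  e₂ = solve-∀

-- The converse estimate (1 + 1/N)^k (1 - k/N) ≤ 1, again without denominators; truncated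
-- subtraction makes it trivial for `k ≥ N`.
bernoulli⁻ : ∀ N k → (1 + N) ^ k * (N ∸ k) ≤ N ^ k * N
bernoulli⁻ N zero = ≤-refl
bernoulli⁻ N (suc k) = begin
  (1 + N) * (1 + N) ^ k * (N ∸ suc k)   ≡⟨ e₁ (1 + N) ((1 + N) ^ k) (N ∸ suc k) ⟩
  (1 + N) ^ k * ((1 + N) * (N ∸ suc k)) ≤⟨ *-monoʳ-≤ ((1 + N) ^ k) step ⟩
  (1 + N) ^ k * (N * (N ∸ k))           ≡⟨ e₂ ((1 + N) ^ k) N (N ∸ k) ⟩
  N * ((1 + N) ^ k * (N ∸ k))           ≤⟨ *-monoʳ-≤ N (bernoulli⁻ N k) ⟩
  N * (N ^ k * N)                       ≡⟨ sym (*-assoc N (N ^ k) N) ⟩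
  N * N ^ k * N                         ∎
  where
  open ≤-Reasoning
  e₁ : ∀ a b c → a * b * c ≡ b * (a * c)
  e₁ = solve-∀
  e₂ : ∀ a b c → a * (b * c) ≡ b * (a * c)
  e₂ = solve-∀
  step : (1 + N) * (N ∸ suc k) ≤ N * (N ∸ k)
  step with suc k ≤? N
  ... | no ¬p rewrite m≤n⇒m∸n≡0 (<⇒≤ (≰⇒> ¬p)) | *-zeroʳ N = z≤n
  ... | yes p with m≤n⇒∃[o]m+o≡n p
  ...   | o , refl = begin
    (1 + N) * (N ∸ suc k)  ≡⟨ cong ((1 + N) *_) (m+n∸m≡n (suc k) o) ⟩
    o + N * o              ≤⟨ +-monoˡ-≤ (N * o) (m≤n+m o (suc k)) ⟩
    N + N * o              ≡⟨ sym (*-suc N o) ⟩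
    N * suc o              ≡⟨ cong (N *_) (sym (trans (cong (_∸ k) (sym (+-suc k o))) (m+n∸m≡n k (suc o)))) ⟩
    N * (N ∸ k)            ∎

[m∸n]*[m+n] : ∀ m n → (m ∸ n) * (m + n) ≡ m * m ∸ n * n
[m∸n]*[m+n] m n = begin
  (m ∸ n) * (m + n)                 ≡⟨ *-distribʳ-∸ (m + n) m n ⟩
  m * (m + n) ∸ n * (m + n)         ≡⟨ cong₂ _∸_ (e₁ m n) (e₂ m n) ⟩
  (m * n + m * m) ∸ (m * n + n * n) ≡⟨ [m+n]∸[m+o]≡n∸o (m * n) (m * m) (n * n) ⟩
  m * m ∸ n * n                     ∎
  where
  open ≡-Reasoning
  e₁ : ∀ m n → m * (m + n) ≡ m * n + m * m
  e₁ = solve-∀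
  e₂ : ∀ m n → n * (m + n) ≡ m * n + n * n
  e₂ = solve-∀

^-distribʳ-* : ∀ n a b → (a * b) ^ n ≡ a ^ n * b ^ n
^-distribʳ-* zero    a b = refl
^-distribʳ-* (suc n) a b = trans (cong (a * b *_) (^-distribʳ-* n a b)) (e a b (a ^ n) (b ^ n))
  where
  e : ∀ a b p q → a * b * (p * q) ≡ a * p * (b * q)
  e = solve-∀

[1+y]^d≤2*y^d : ∀ y d → 0 < y → 2 * d ≤ y → (1 + y) ^ d ≤ 2 * y ^ d
[1+y]^d≤2*y^d y@(suc _) d _ 2d≤y = *-cancelʳ-≤ _ _ y (begin
  (1 + y) ^ d * y                ≤⟨ *-monoʳ-≤ ((1 + y) ^ d) half ⟩
  (1 + y) ^ d * (2 * (y ∸ d))    ≡⟨ e ((1 + y) ^ d) (y ∸ d) ⟩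
  2 * ((1 + y) ^ d * (y ∸ d))    ≤⟨ *-monoʳ-≤ 2 (bernoulli⁻ y d) ⟩
  2 * (y ^ d * y)                ≡⟨ sym (*-assoc 2 (y ^ d) y) ⟩
  2 * y ^ d * y                  ∎)
  where
  open ≤-Reasoning
  e : ∀ a b → a * (2 * b) ≡ 2 * (a * b)
  e = solve-∀
  half : y ≤ 2 * (y ∸ d)
  half = begin
    y                      ≡⟨ sym (m+n∸n≡m y y) ⟩
    (y + y) ∸ y            ≤⟨ ∸-monoʳ-≤ (y + y) 2d≤y ⟩
    (y + y) ∸ 2 * d        ≡⟨ cong (λ w → (y + w) ∸ 2 * d) (sym (+-identityʳ y)) ⟩
    2 * y ∸ 2 * d          ≡⟨ sym (*-distribˡ-∸ 2 y d) ⟩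
    2 * (y ∸ d)            ∎

2*N^N≤[1+N]^N : ∀ N → 0 < N → 2 * N ^ N ≤ (1 + N) ^ N
2*N^N≤[1+N]^N N@(suc _) _ = *-cancelˡ-≤ N (begin
  N * (2 * N ^ N)    ≡⟨ e N (N ^ N) ⟩
  N ^ N * (N + N)    ≤⟨ bernoulli N N ⟩
  N * (1 + N) ^ N    ∎)
  where
  open ≤-Reasoning
  e : ∀ a b → a * (2 * b) ≡ b * (a + a)
  e = solve-∀

-- Chernoff's bound: a bound m on (1 + x/N)^α (1 - y/N)^β, with N = d L and L² > 2 d,
-- bounds the deviation α x - β y by N log₂ (2 m).  The quadratic error terms are
-- absorbed by the factor 2, as (1 - 1/L²)^d ≥ 1/2.
module _ (d L lam m x y α β : ℕ) (0<d : 0 < d) (x≤d : x ≤ d) (y≤d : y ≤ d)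
         (α+β : α + β ≡ d) (2d<L² : 2 * d < L * L) (2m<2^lam : 2 * m < 2 ^ lam) where
  private
    N Q : ℕ
    N = d * L
    Q = N * N ∸ d * d

    0<N : 0 < N
    0<N = *-mono-≤ 0<d (0<L L 2d<L²)
      where
      0<L : ∀ L → 2 * d < L * L → 0 < L
      0<L (suc _) _ = z<s

    Q≤ : ∀ x → x ≤ d → Q ≤ (N ∸ x) * (N + x)
    Q≤ x x≤d = ≤-trans (∸-monoʳ-≤ (N * N) (*-mono-≤ x≤d x≤d)) (≤-reflexive (sym ([m∸n]*[m+n] N x)))

    -- Replaces 1 + x/N by the power (1 + 1/N)^x at the cost of the factor Q/N² = 1 - 1/L²; `down`
    -- does the same for 1 - y/N. All factors thereby become powers of one base, whose exponents can
    -- be compared.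
    up : (1 + N) ^ x * Q ≤ (N + x) * (N ^ x * N)
    up = begin
      (1 + N) ^ x * Q                     ≤⟨ *-monoʳ-≤ ((1 + N) ^ x) (Q≤ x x≤d) ⟩
      (1 + N) ^ x * ((N ∸ x) * (N + x))   ≡⟨ sym (*-assoc ((1 + N) ^ x) _ _) ⟩
      (1 + N) ^ x * (N ∸ x) * (N + x)     ≤⟨ *-monoˡ-≤ (N + x) (bernoulli⁻ N x) ⟩
      N ^ x * N * (N + x)                 ≡⟨ *-comm _ (N + x) ⟩
      (N + x) * (N ^ x * N)               ∎
      where open ≤-Reasoning

    down : N ^ y * Q ≤ (N ∸ y) * (N * (1 + N) ^ y)
    down = begin
      N ^ y * Q                       ≤⟨ *-monoʳ-≤ (N ^ y) (Q≤ y y≤d) ⟩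
      N ^ y * ((N ∸ y) * (N + y))     ≡⟨ e (N ^ y) (N ∸ y) (N + y) ⟩
      (N ∸ y) * (N ^ y * (N + y))     ≤⟨ *-monoʳ-≤ (N ∸ y) (bernoulli N y) ⟩
      (N ∸ y) * (N * (1 + N) ^ y)     ∎
      where
      open ≤-Reasoning
      e : ∀ a b c → a * (b * c) ≡ b * (a * c)
      e = solve-∀

    N²ᵈ≤2Qᵈ : N ^ d * N ^ d ≤ 2 * Q ^ d
    N²ᵈ≤2Qᵈ = begin
      N ^ d * N ^ d                          ≡⟨ sym (^-distribʳ-* d N N) ⟩
      (N * N) ^ d                            ≡⟨ cong (_^ d) (e₁ d L) ⟩
      (d * d * (L * L)) ^ d                  ≡⟨ ^-distribʳ-* d (d * d) (L * L) ⟩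
      (d * d) ^ d * (L * L) ^ d              ≤⟨ *-monoʳ-≤ ((d * d) ^ d) (half 2d<L²) ⟩
      (d * d) ^ d * (2 * (L * L ∸ 1) ^ d)    ≡⟨ e₂ ((d * d) ^ d) ((L * L ∸ 1) ^ d) ⟩
      2 * ((d * d) ^ d * (L * L ∸ 1) ^ d)    ≡⟨ cong (2 *_) (sym (^-distribʳ-* d (d * d) (L * L ∸ 1))) ⟩
      2 * (d * d * (L * L ∸ 1)) ^ d          ≡⟨ cong (λ w → 2 * w ^ d) e₃ ⟩
      2 * Q ^ d                              ∎
      where
      open ≤-Reasoning
      e₁ : ∀ d L → d * L * (d * L) ≡ d * d * (L * L)
      e₁ = solve-∀
      e₂ : ∀ a b → a * (2 * b) ≡ 2 * (a * b)
      e₂ = solve-∀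
      half : ∀ {y} → 2 * d < y → y ^ d ≤ 2 * (y ∸ 1) ^ d
      half {suc y} (s≤s 2d≤y) = [1+y]^d≤2*y^d y d (≤-trans (≤-trans 0<d (m≤m+n d _)) 2d≤y) 2d≤y
      e₃ : d * d * (L * L ∸ 1) ≡ Q
      e₃ = trans (*-distribˡ-∸ (d * d) (L * L) 1)
                 (cong₂ _∸_ (sym (e₁ d L)) (*-identityʳ (d * d)))

  chernoff : (N + x) ^ α * (N ∸ y) ^ β ≤ m * N ^ d → x * α ≤ y * β + N * lam
  chernoff prod with x * α ≤? y * β + N * lam
  ... | yes p = p
  ... | no ¬p with m≤n⇒∃[o]m+o≡n (<⇒≤ (≰⇒> ¬p))
  ...   | o , eq = ⊥-elim (<⇒≱ 2m<2^lam (*-cancelʳ-≤ (2 ^ lam) (2 * m) (N ^ X)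
                     {{m^n≢0 N X {{>-nonZero 0<N}}}} 2^lam≤))
    where
    open ≤-Reasoning
    X : ℕ
    X = N * lam + o
    xα : x * α ≡ y * β + X
    xα = trans (sym eq) (+-assoc (y * β) (N * lam) o)

    pow : ∀ a b c → (a ^ b) ^ c ≡ a ^ (b * c)
    pow = ^-*-assoc

    upα : (1 + N) ^ (x * α) * Q ^ α ≤ (N + x) ^ α * (N ^ (x * α) * N ^ α)
    upα = begin
      (1 + N) ^ (x * α) * Q ^ α         ≡⟨ cong (_* Q ^ α) (sym (pow (1 + N) x α)) ⟩
      ((1 + N) ^ x) ^ α * Q ^ α         ≡⟨ sym (^-distribʳ-* α ((1 + N) ^ x) Q) ⟩
      ((1 + N) ^ x * Q) ^ α             ≤⟨ ^-monoˡ-≤ α up ⟩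
      ((N + x) * (N ^ x * N)) ^ α       ≡⟨ ^-distribʳ-* α (N + x) _ ⟩
      (N + x) ^ α * (N ^ x * N) ^ α     ≡⟨ cong ((N + x) ^ α *_) (^-distribʳ-* α (N ^ x) N) ⟩
      (N + x) ^ α * ((N ^ x) ^ α * N ^ α) ≡⟨ cong (λ w → (N + x) ^ α * (w * N ^ α)) (pow N x α) ⟩
      (N + x) ^ α * (N ^ (x * α) * N ^ α) ∎

    downβ : N ^ (y * β) * Q ^ β ≤ (N ∸ y) ^ β * (N ^ β * (1 + N) ^ (y * β))
    downβ = begin
      N ^ (y * β) * Q ^ β               ≡⟨ cong (_* Q ^ β) (sym (pow N y β)) ⟩
      (N ^ y) ^ β * Q ^ β               ≡⟨ sym (^-distribʳ-* β (N ^ y) Q) ⟩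
      (N ^ y * Q) ^ β                   ≤⟨ ^-monoˡ-≤ β down ⟩
      ((N ∸ y) * (N * (1 + N) ^ y)) ^ β ≡⟨ ^-distribʳ-* β (N ∸ y) _ ⟩
      (N ∸ y) ^ β * (N * (1 + N) ^ y) ^ β ≡⟨ cong ((N ∸ y) ^ β *_) (^-distribʳ-* β N _) ⟩
      (N ∸ y) ^ β * (N ^ β * ((1 + N) ^ y) ^ β) ≡⟨ cong (λ w → (N ∸ y) ^ β * (N ^ β * w)) (pow (1 + N) y β) ⟩
      (N ∸ y) ^ β * (N ^ β * (1 + N) ^ (y * β)) ∎

    -- The factor common to both sides of `combined`. Cancelling it leaves only `X`, the excess of
    -- `x * α` over `y * β`, in the exponents.
    N₁ : ℕ
    N₁ = (1 + N) ^ (y * β) * N ^ (y * β) * (N ^ d * N ^ d)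

    combined : (1 + N) ^ X * N₁ ≤ 2 * m * N ^ X * N₁
    combined = begin
      (1 + N) ^ X * N₁
        ≤⟨ *-monoʳ-≤ ((1 + N) ^ X) (*-monoʳ-≤ ((1 + N) ^ (y * β) * N ^ (y * β)) N²ᵈ≤2Qᵈ) ⟩
      (1 + N) ^ X * ((1 + N) ^ (y * β) * N ^ (y * β) * (2 * Q ^ d))
        ≡⟨ e₁ ((1 + N) ^ X) ((1 + N) ^ (y * β)) (N ^ (y * β)) (Q ^ d) ⟩
      2 * ((1 + N) ^ (y * β) * (1 + N) ^ X * (N ^ (y * β) * Q ^ d))
        ≡⟨ cong₂ (λ v w → 2 * (v * (N ^ (y * β) * w)))
             (trans (sym (^-distribˡ-+-* (1 + N) (y * β) X)) (cong ((1 + N) ^_) (sym xα)))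
             (trans (cong (Q ^_) (sym α+β)) (^-distribˡ-+-* Q α β)) ⟩
      2 * ((1 + N) ^ (x * α) * (N ^ (y * β) * (Q ^ α * Q ^ β)))
        ≡⟨ e₂ ((1 + N) ^ (x * α)) (N ^ (y * β)) (Q ^ α) (Q ^ β) ⟩
      2 * (((1 + N) ^ (x * α) * Q ^ α) * (N ^ (y * β) * Q ^ β))
        ≤⟨ *-monoʳ-≤ 2 (*-mono-≤ upα downβ) ⟩
      2 * ((N + x) ^ α * (N ^ (x * α) * N ^ α) * ((N ∸ y) ^ β * (N ^ β * (1 + N) ^ (y * β))))
        ≡⟨ e₃ ((N + x) ^ α) (N ^ (x * α)) (N ^ α) ((N ∸ y) ^ β) (N ^ β) ((1 + N) ^ (y * β)) ⟩
      2 * (((N + x) ^ α * (N ∸ y) ^ β) * (N ^ (x * α) * (N ^ α * N ^ β) * (1 + N) ^ (y * β)))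
        ≤⟨ *-monoʳ-≤ 2 (*-monoˡ-≤ _ prod) ⟩
      2 * (m * N ^ d * (N ^ (x * α) * (N ^ α * N ^ β) * (1 + N) ^ (y * β)))
        ≡⟨ cong₂ (λ v w → 2 * (m * N ^ d * (v * w * (1 + N) ^ (y * β))))
             (trans (cong (N ^_) xα) (^-distribˡ-+-* N (y * β) X))
             (trans (sym (^-distribˡ-+-* N α β)) (cong (N ^_) α+β)) ⟩
      2 * (m * N ^ d * (N ^ (y * β) * N ^ X * N ^ d * (1 + N) ^ (y * β)))
        ≡⟨ e₄ m (N ^ d) (N ^ (y * β)) (N ^ X) ((1 + N) ^ (y * β)) ⟩
      2 * m * N ^ X * N₁ ∎
      where
      e₁ : ∀ a b c q → a * (b * c * (2 * q)) ≡ 2 * (b * a * (c * q))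
      e₁ = solve-∀
      e₂ : ∀ a b c q → 2 * (a * (b * (c * q))) ≡ 2 * ((a * c) * (b * q))
      e₂ = solve-∀
      e₃ : ∀ a b c p q r → 2 * (a * (b * c) * (p * (q * r))) ≡ 2 * ((a * p) * (b * (c * q) * r))
      e₃ = solve-∀
      e₄ : ∀ m q b c r → 2 * (m * q * (b * c * q * r)) ≡ 2 * m * c * (r * b * (q * q))
      e₄ = solve-∀

    instance
      nzN : NonZero N
      nzN = >-nonZero 0<N
      nzN₁ : NonZero N₁
      nzN₁ = m*n≢0 _ _ {{m*n≢0 _ _ {{m^n≢0 (1 + N) (y * β)}} {{m^n≢0 N (y * β)}}}}
                       {{m*n≢0 _ _ {{m^n≢0 N d}} {{m^n≢0 N d}}}}

    2^lam≤ : 2 ^ lam * N ^ X ≤ 2 * m * N ^ X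
    2^lam≤ = begin
      2 ^ lam * N ^ X                     ≡⟨ cong (2 ^ lam *_) (^-distribˡ-+-* N (N * lam) o) ⟩
      2 ^ lam * (N ^ (N * lam) * N ^ o)   ≡⟨ sym (*-assoc (2 ^ lam) _ _) ⟩
      2 ^ lam * N ^ (N * lam) * N ^ o     ≡⟨ cong (λ w → 2 ^ lam * w * N ^ o) (sym (pow N N lam)) ⟩
      2 ^ lam * (N ^ N) ^ lam * N ^ o     ≡⟨ cong (_* N ^ o) (sym (^-distribʳ-* lam 2 (N ^ N))) ⟩
      -- Each `N` in the exponent of 1 + 1/N is worth a doubling, so an excess of `N * lam` yields
      -- `2 ^ lam`.
      (2 * N ^ N) ^ lam * N ^ o           ≤⟨ *-mono-≤ (^-monoˡ-≤ lam (2*N^N≤[1+N]^N N 0<N)) (^-monoˡ-≤ o (n≤1+n N)) ⟩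
      ((1 + N) ^ N) ^ lam * (1 + N) ^ o   ≡⟨ cong (_* (1 + N) ^ o) (pow (1 + N) N lam) ⟩
      (1 + N) ^ (N * lam) * (1 + N) ^ o   ≡⟨ sym (^-distribˡ-+-* (1 + N) (N * lam) o) ⟩
      (1 + N) ^ X                         ≤⟨ *-cancelʳ-≤ _ _ N₁ combined ⟩
      2 * m * N ^ X                       ∎

-- Equidistributed colourings

𝟙-split : ∀ a b → 𝟙 (a ∧ b) + 𝟙 (a ∧ not b) ≡ 𝟙 a
𝟙-split false b     = refl
𝟙-split true  true  = refl
𝟙-split true  false = refl

nbrs : ∀ {n} → Graph n → Fin n → (Fin n → Bool) → ℕ
nbrs G v A = ∑ (λ u → 𝟙 (adj G v u ∧ A u))

nbrs-split : ∀ {n} (G : Graph n) v A → nbrs G v A + nbrs G v (λ u → not (A u)) ≡ deg G v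
nbrs-split G v A = trans (sym (∑-distrib-+ (λ u → 𝟙 (adj G v u ∧ A u)) _))
                         (∑-cong (λ u → 𝟙-split (adj G v u) (A u)))

module _ {n d : ℕ} (G : Graph n) (reg : Regular G d) (0<d : 0 < d)
         (L lam : ℕ) (2d<L² : 2 * d < L * L) (2m<2^lam : 2 * (n * suc d * 2) < 2 ^ lam) where
  private
    N m : ℕ
    N = d * L
    m = n * suc d * 2

    d≤N : d ≤ N
    d≤N = go L 2d<L²
      where
      go : ∀ L → 2 * d < L * L → d ≤ d * L
      go (suc L) _ = m≤m*n d (suc L)

    -- Linear substitutes for exponential weights. Each side of the threshold is shifted by the
    -- number of colours on the other side, so the average over all `d` colours is exactly `N`.
    -- Index 0 detects too many neighbours below `t`, index 1 too few.
    lowF highF : ℕ → Fin 2 → ℕ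
    lowF  t zero    = N + (d ∸ t)
    lowF  t (suc _) = N ∸ (d ∸ t)
    highF t zero    = N ∸ t
    highF t (suc _) = N + t

    factor : Fin n → ℕ → Fin 2 → Fin n → Fin d → ℕ
    factor v t σ u i = if adj G v u then (if toℕ i <ᵇ t then lowF t σ else highF t σ) else N

    balanced : ∀ t σ → t ≤ d → t * lowF t σ + (d ∸ t) * highF t σ ≡ d * N
    balanced t zero t≤d = begin
      t * (N + s) + s * (N ∸ t)       ≡⟨ cong (_+ s * (N ∸ t)) (e t N s) ⟩
      (t * N + s * t) + s * (N ∸ t)   ≡⟨ +-assoc (t * N) (s * t) _ ⟩
      t * N + (s * t + s * (N ∸ t))   ≡⟨ cong (t * N +_) (sym (*-distribˡ-+ s t (N ∸ t))) ⟩
      t * N + s * (t + (N ∸ t))       ≡⟨ cong (λ w → t * N + s * w) (m+[n∸m]≡n (≤-trans t≤d d≤N)) ⟩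
      t * N + s * N                   ≡⟨ sym (*-distribʳ-+ N t s) ⟩
      (t + s) * N                     ≡⟨ cong (_* N) (m+[n∸m]≡n t≤d) ⟩
      d * N                           ∎
      where
      open ≡-Reasoning
      s : ℕ
      s = d ∸ t
      e : ∀ t N s → t * (N + s) ≡ t * N + s * t
      e = solve-∀
    balanced t (suc _) t≤d = begin
      t * (N ∸ s) + s * (N + t)       ≡⟨ e t N s (N ∸ s) ⟩
      t * (s + (N ∸ s)) + s * N       ≡⟨ cong (λ w → t * w + s * N) (m+[n∸m]≡n (≤-trans (m∸n≤m d t) d≤N)) ⟩
      t * N + s * N                   ≡⟨ sym (*-distribʳ-+ N t s) ⟩
      (t + s) * N                     ≡⟨ cong (_* N) (m+[n∸m]≡n t≤d) ⟩
      d * N                           ∎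
      where
      open ≡-Reasoning
      s : ℕ
      s = d ∸ t
      e : ∀ t N s r → t * r + s * (N + t) ≡ t * (s + r) + s * N
      e = solve-∀

    average : ∀ v t σ u → t ≤ d → ∑ (factor v t σ u) ≤ d * N
    average v t σ u t≤d with adj G v u
    ... | false = ≤-reflexive (∑-const d N)
    ... | true  = ≤-reflexive (trans (∑-threshold d t (lowF t σ) (highF t σ) t≤d) (balanced t σ t≤d))

    F₁ : Fin n × Fin (suc d) → Fin 2 → Fin n → Fin d → ℕ
    F₁ (v , t) σ = factor v (toℕ t) σ

    F₂ : Fin (n * suc d) × Fin 2 → Fin n → Fin d → ℕ
    F₂ (vt , σ) = F₁ (remQuot (suc d) vt) σ

    F : Fin m → Fin n → Fin d → ℕ
    F j = F₂ (remQuot 2 j)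

    choice : Σ (Fin n → Fin d) λ c → ∑ (λ j → 1 * ∏ (λ u → F j u (c u))) ≤ ∑ {m} (λ _ → 1) * N ^ n
    choice = choose-below-average n N 0<d F
      (λ j u → average _ _ (proj₂ (remQuot {n * suc d} 2 j)) u (≤-pred (toℕ<n (proj₂ (remQuot {n} (suc d) (proj₁ (remQuot 2 j))))))) (λ _ → 1)

    c : Fin n → Fin d
    c = proj₁ choice

    F-combine : ∀ v (t : Fin (suc d)) σ → F (combine (combine v t) σ) ≡ factor v (toℕ t) σ
    F-combine v t σ = trans (cong F₂ (remQuot-combine (combine v t) σ))
                            (cong (λ vt → F₁ vt σ) (remQuot-combine v t))

    -- The union bound: all tests have weight 1 and nonnegative products, so the bound on the total
    -- holds for each of them. Thus `m` enters the deviation only through its logarithm.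
    term : ∀ v t σ → t ≤ d → ∏ (λ u → factor v t σ u (c u)) ≤ m * N ^ n
    term v t σ t≤d = begin
      ∏ (λ u → factor v t σ u (c u))
        ≡⟨ cong (λ t → ∏ (λ u → factor v t σ u (c u))) (sym (toℕ-fromℕ< (s≤s t≤d))) ⟩
      ∏ (λ u → factor v (toℕ t′) σ u (c u))
        ≡⟨ cong (λ f → ∏ (λ u → f u (c u))) (sym (F-combine v t′ σ)) ⟩
      ∏ (λ u → F j u (c u))                      ≡⟨ sym (*-identityˡ _) ⟩
      1 * ∏ (λ u → F j u (c u))                  ≤⟨ term≤∑ (λ j → 1 * ∏ (λ u → F j u (c u))) j ⟩
      ∑ (λ j → 1 * ∏ (λ u → F j u (c u)))        ≤⟨ proj₂ choice ⟩
      ∑ {m} (λ _ → 1) * N ^ n                    ≡⟨ cong (_* N ^ n) (trans (∑-const m 1) (*-identityʳ m)) ⟩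
      m * N ^ n                                  ∎
      where
      open ≤-Reasoning
      t′ : Fin (suc d)
      t′ = fromℕ< (s≤s t≤d)
      j : Fin m
      j = combine (combine v t′) σ

    module _ (v : Fin n) (t : ℕ) (t≤d : t ≤ d) where
      a b : ℕ
      a = nbrs G v (λ u → toℕ (c u) <ᵇ t)
      b = nbrs G v (λ u → not (toℕ (c u) <ᵇ t))

      a+b : a + b ≡ d
      a+b = trans (nbrs-split G v _) (reg v)

      instance
        nzd : NonZero d
        nzd = >-nonZero 0<d
        nzN : NonZero N
        nzN = >-nonZero (≤-trans 0<d d≤N)

      powers : ∀ σ → lowF t σ ^ a * highF t σ ^ b ≤ m * N ^ d
      powers σ = *-cancelʳ-≤ _ _ (N ^ n) {{m^n≢0 N n}} (begin
        lowF t σ ^ a * highF t σ ^ b * N ^ n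
          ≡⟨ ∏-three-valued (adj G v) (λ u → toℕ (c u) <ᵇ t) (lowF t σ) (highF t σ) N ⟩
        ∏ (λ u → factor v t σ u (c u)) * N ^ (a + b)
          ≤⟨ *-monoˡ-≤ (N ^ (a + b)) (term v t σ t≤d) ⟩
        m * N ^ n * N ^ (a + b)   ≡⟨ cong (λ w → m * N ^ n * N ^ w) a+b ⟩
        m * N ^ n * N ^ d         ≡⟨ e m (N ^ n) (N ^ d) ⟩
        m * N ^ d * N ^ n         ∎)
        where
        open ≤-Reasoning
        e : ∀ a b c → a * b * c ≡ a * c * b
        e = solve-∀

      up : (d ∸ t) * a ≤ t * b + N * lam
      up = chernoff d L lam m (d ∸ t) t a b 0<d (m∸n≤m d t) t≤d a+b 2d<L² 2m<2^lam (powers zero)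

      dn : t * b ≤ (d ∸ t) * a + N * lam
      dn = chernoff d L lam m t (d ∸ t) b a 0<d t≤d (m∸n≤m d t) (trans (+-comm b a) a+b) 2d<L² 2m<2^lam
             (≤-trans (≤-reflexive (*-comm (highF t (suc zero) ^ b) _)) (powers (suc zero)))

      -- With a + b = d, the quantity (d - t) a - t b equals d (a - t), so `up` divided by `d` is
      -- the claim. `lower` follows from `dn` in the same way.
      upper : a ≤ t + L * lam
      upper = *-cancelˡ-≤ d (begin
        d * a                          ≡⟨ cong (_* a) (sym (m+[n∸m]≡n t≤d)) ⟩
        (t + (d ∸ t)) * a              ≡⟨ *-distribʳ-+ a t (d ∸ t) ⟩
        t * a + (d ∸ t) * a            ≤⟨ +-monoʳ-≤ (t * a) up ⟩
        t * a + (t * b + N * lam)      ≡⟨ e t a b (N * lam) ⟩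
        (a + b) * t + N * lam          ≡⟨ cong (λ w → w * t + N * lam) a+b ⟩
        d * t + d * L * lam            ≡⟨ cong (d * t +_) (*-assoc d L lam) ⟩
        d * t + d * (L * lam)          ≡⟨ sym (*-distribˡ-+ d t (L * lam)) ⟩
        d * (t + L * lam)              ∎)
        where
        open ≤-Reasoning
        e : ∀ t a b x → t * a + (t * b + x) ≡ (a + b) * t + x
        e = solve-∀

      lower : t ≤ a + L * lam
      lower = *-cancelˡ-≤ d (begin
        d * t                               ≡⟨ cong (_* t) (sym a+b) ⟩
        (a + b) * t                         ≡⟨ e₁ t a b ⟩
        t * a + t * b                       ≤⟨ +-monoʳ-≤ (t * a) dn ⟩
        t * a + ((d ∸ t) * a + N * lam)     ≡⟨ e₂ t (d ∸ t) a (N * lam) ⟩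
        (t + (d ∸ t)) * a + N * lam         ≡⟨ cong (λ w → w * a + N * lam) (m+[n∸m]≡n t≤d) ⟩
        d * a + d * L * lam                 ≡⟨ cong (d * a +_) (*-assoc d L lam) ⟩
        d * a + d * (L * lam)               ≡⟨ sym (*-distribˡ-+ d a (L * lam)) ⟩
        d * (a + L * lam)                   ∎)
        where
        open ≤-Reasoning
        e₁ : ∀ t a b → (a + b) * t ≡ t * a + t * b
        e₁ = solve-∀
        e₂ : ∀ t r a x → t * a + (r * a + x) ≡ (t + r) * a + x
        e₂ = solve-∀

  equidistributed-colouring :
    Σ (Fin n → Fin d) λ c → ∀ v t → t ≤ d →
      (nbrs G v (λ u → toℕ (c u) <ᵇ t) ≤ t + L * lam) × (t ≤ nbrs G v (λ u → toℕ (c u) <ᵇ t) + L * lam)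
  equidistributed-colouring = c , λ v t t≤d → upper v t t≤d , lower v t t≤d

-- Asymptotics

∃-log₂ : ∀ d → 0 < d → Σ ℕ λ μ → 2 ^ μ ≤ d × d < 2 ^ suc μ
∃-log₂ (suc zero)    _ = 0 , s≤s z≤n , s≤s (s≤s z≤n)
∃-log₂ (suc (suc d)) _ with ∃-log₂ (suc d) z<s
... | μ , lo , hi with suc (suc d) <? 2 ^ suc μ
...   | yes p = μ , m≤n⇒m≤1+n lo , p
...   | no ¬p = suc μ , ≮⇒≥ ¬p , (begin-strict
        suc (suc d)          ≤⟨ hi ⟩
        2 ^ suc μ            <⟨ ^-monoʳ-< 2 (s≤s (s≤s z≤n)) (n<1+n (suc μ)) ⟩
        2 ^ suc (suc μ)      ∎)
  where open ≤-Reasoning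

∃-sqrt : ∀ m → Σ ℕ λ s → s * s ≤ m × m < suc s * suc s
∃-sqrt zero = 0 , z≤n , z<s
∃-sqrt (suc m) with ∃-sqrt m
... | s , lo , hi with suc m <? suc s * suc s
...   | yes p = s , m≤n⇒m≤1+n lo , p
...   | no ¬p = suc s , ≮⇒≥ ¬p , ≤-<-trans hi (*-mono-< (n<1+n (suc s)) (n<1+n (suc s)))

[3+j]³≤2[2+j]³ : ∀ j → 2 ≤ j → (3 + j) * (3 + j) * (3 + j) ≤ 2 * ((2 + j) * (2 + j) * (2 + j))
[3+j]³≤2[2+j]³ (suc (suc x)) (s≤s (s≤s _)) = begin
  (5 + x) * (5 + x) * (5 + x)                       ≤⟨ m≤m+n _ (3 + 21 * x + 9 * (x * x) + x * x * x) ⟩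
  (5 + x) * (5 + x) * (5 + x) + (3 + 21 * x + 9 * (x * x) + x * x * x) ≡⟨ e x ⟩
  2 * ((4 + x) * (4 + x) * (4 + x))                 ∎
  where
  open ≤-Reasoning
  e : ∀ x → (5 + x) * (5 + x) * (5 + x) + (3 + 21 * x + 9 * (x * x) + x * x * x)
            ≡ 2 * ((4 + x) * (4 + x) * (4 + x))
  e = solve-∀

-- The exponent 12 is the first at which 2^j overtakes the cube: 14³ = 2744 is below 4096, whereas
-- 13³ = 2197 exceeds 2048.
[2+j]³≤2^j : ∀ {j} → 12 ≤′ j → (2 + j) * (2 + j) * (2 + j) ≤ 2 ^ j
[2+j]³≤2^j ≤′-refl = ≤ᵇ⇒≤ _ _ _
[2+j]³≤2^j (≤′-step {j} p) =
  ≤-trans ([3+j]³≤2[2+j]³ j (≤-trans (s≤s (s≤s z≤n)) (≤′⇒≤ p))) (*-monoʳ-≤ 2 ([2+j]³≤2^j p))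

-- The third factor of the cube is left over to absorb the constant `A`.
quadratic<2^ : ∀ A j → 12 + A ≤ j → A * ((2 + j) * (2 + j)) < 2 ^ j
quadratic<2^ A j 12+A≤j = begin-strict
  A * ((2 + j) * (2 + j))              <⟨ *-monoˡ-< ((2 + j) * (2 + j)) A<2+j ⟩
  (2 + j) * ((2 + j) * (2 + j))        ≡⟨ sym (*-assoc (2 + j) (2 + j) (2 + j)) ⟩
  (2 + j) * (2 + j) * (2 + j)          ≤⟨ [2+j]³≤2^j (≤⇒≤′ (≤-trans (m≤m+n 12 A) 12+A≤j)) ⟩
  2 ^ j                                ∎
  where
  open ≤-Reasoning
  A<2+j : A < 2 + j
  A<2+j = s≤s (≤-trans (≤-trans (m≤n+m A 12) 12+A≤j) (n≤1+n j))

-- Reduces to the case without the power at j = ⌊μ/q⌋, since (2^j)^q ≤ 2^μ. Replacing `μ` by `j` in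
-- the base costs only the constant q².
[quadratic]^q<2^ : ∀ A q → 0 < q → Σ ℕ λ μ₀ → ∀ μ → μ₀ ≤ μ → (A * ((2 + μ) * (2 + μ))) ^ q < 2 ^ μ
[quadratic]^q<2^ A q@(suc q-1) _ = q * j₀ , bound
  where
  j₀ : ℕ
  j₀ = 12 + A * (q * q)
  bound : ∀ μ → q * j₀ ≤ μ → (A * ((2 + μ) * (2 + μ))) ^ q < 2 ^ μ
  bound μ le = begin-strict
    (A * ((2 + μ) * (2 + μ))) ^ q                   ≤⟨ ^-monoˡ-≤ q (*-monoʳ-≤ A (*-mono-≤ 2+μ≤ 2+μ≤)) ⟩
    (A * (q * (2 + j) * (q * (2 + j)))) ^ q         ≡⟨ cong (_^ q) (e A q (2 + j)) ⟩
    (A * (q * q) * ((2 + j) * (2 + j))) ^ q         <⟨ ^-monoˡ-< q (quadratic<2^ (A * (q * q)) j j₀≤j) ⟩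
    (2 ^ j) ^ q                                     ≡⟨ ^-*-assoc 2 j q ⟩
    2 ^ (j * q)                                     ≤⟨ ^-monoʳ-≤ 2 (m/n*n≤m μ q) ⟩
    2 ^ μ                                           ∎
    where
    open ≤-Reasoning
    j : ℕ
    j = μ / q
    e : ∀ A q x → A * (q * x * (q * x)) ≡ A * (q * q) * (x * x)
    e = solve-∀
    j₀≤j : j₀ ≤ j
    j₀≤j = ≤-trans (≤-reflexive (sym (m*n/n≡m j₀ q))) (/-monoˡ-≤ q (≤-trans (≤-reflexive (*-comm j₀ q)) le))
    2+μ≤ : 2 + μ ≤ q * (2 + j)
    2+μ≤ = begin
      2 + μ                    ≡⟨ cong (2 +_) (m≡m%n+[m/n]*n μ q) ⟩
      2 + (μ % q + j * q)      ≤⟨ +-monoʳ-≤ 2 (+-monoˡ-≤ (j * q) (≤-pred (m%n<n μ q))) ⟩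
      2 + (q-1 + j * q)        ≤⟨ m≤m+n _ q-1 ⟩
      2 + (q-1 + j * q) + q-1  ≡⟨ e₂ q-1 j ⟩
      q * (2 + j)              ∎
      where
      e₂ : ∀ p j → 2 + (p + j * suc p) + p ≡ suc p * (2 + j)
      e₂ = solve-∀

^-cancelˡ-≤ : ∀ q → 0 < q → ∀ {a b} → a ^ q ≤ b ^ q → a ≤ b
^-cancelˡ-≤ (suc q) _ {a} {b} le with a ≤? b
... | yes p = p
... | no ¬p = ⊥-elim (<⇒≱ (^-monoˡ-< (suc q) (≰⇒> ¬p)) le)

square-cancel-< : ∀ {a b} → a * a < b * b → a < b
square-cancel-< {a} {b} lt with a <? b
... | yes p = p
... | no ¬p = ⊥-elim (<⇒≱ lt (*-mono-≤ (≮⇒≥ ¬p) (≮⇒≥ ¬p)))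

-- L ≈ √d and lam ≈ log d, so the last inequality amounts to (n/d)⁴ log² d = o(d); this is where β < 1/4 enters.
module _ (p q : ℕ) (4p<q : 4 * p < q) (C : ℕ) where
  private
    0<q : 0 < q
    0<q = ≤-trans (s≤s z≤n) 4p<q

    -- Collected by squaring the last bound of `parameters-exist`: 28² from `κ + 27 ≤ 28 * κ⁺`, 2
    -- from absorbing the `+ 1` after `L * lam`, 8 from `L * L ≤ 8 * d`, and 9 from the 3 in `lam`.
    C₀ A : ℕ
    C₀ = 2 * C * (28 * 28)
    A = 8 * (C₀ * C₀) * 9

  abstract
    parameters-exist : Σ ℕ λ d₀ → ∀ d → d₀ ≤ d → ∀ n κ → κ * d ≤ n → n ^ q ≤ d ^ (p + q) →
      0 < d × Σ ℕ λ L → Σ ℕ λ lam →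
        (2 * d < L * L) × (2 * (n * suc d * 2) < 2 ^ lam) ×
        (C * ((κ + 27) * (κ + 27)) * (L * lam + 1) < d)
    parameters-exist with [quadratic]^q<2^ A q 0<q
    ... | μ₀ , growth = 2 ^ μ₀ , λ d d₀≤d n κ κd≤n hyp →
        let open Large d d₀≤d n κ κd≤n hyp in 0<d , L , lam , 2d<L² , big , small
      where
      module Large (d : ℕ) (d₀≤d : 2 ^ μ₀ ≤ d) (n κ : ℕ) (κd≤n : κ * d ≤ n) (hyp : n ^ q ≤ d ^ (p + q)) where
        0<d : 0 < d
        0<d = ≤-trans (m^n>0 2 μ₀) d₀≤d
        instance
          nzd : NonZero d
          nzd = >-nonZero 0<d

        log : Σ ℕ λ μ → 2 ^ μ ≤ d × d < 2 ^ suc μ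
        log = ∃-log₂ d 0<d
        μ lam : ℕ
        μ = proj₁ log
        -- As n ≤ d², the number of tests is cubic in d: twice it is at most 8 d³, which is less
        -- than (2^(2 + μ))³.
        lam = 3 * (2 + μ)

        μ₀≤μ : μ₀ ≤ μ
        μ₀≤μ with μ₀ ≤? μ
        ... | yes le = le
        ... | no ¬le = ⊥-elim (<⇒≱ (proj₂ (proj₂ log)) (≤-trans (^-monoʳ-≤ 2 (≰⇒> ¬le)) d₀≤d))

        sqrt : Σ ℕ λ s → s * s ≤ 2 * d × 2 * d < suc s * suc s
        sqrt = ∃-sqrt (2 * d)
        L : ℕ
        L = suc (proj₁ sqrt)

        2d<L² : 2 * d < L * L
        2d<L² = proj₂ (proj₂ sqrt)

        0<sqrt : ∀ s → 2 * d < suc s * suc s → 0 < s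
        0<sqrt zero    lt = ⊥-elim (<⇒≱ lt (≤-trans 0<d (m≤m+n d _)))
        0<sqrt (suc s) lt = z<s

        L²≤8d : L * L ≤ 8 * d
        L²≤8d = begin
          L * L                ≤⟨ *-mono-≤ L≤2s L≤2s ⟩
          (s + s) * (s + s)    ≡⟨ e s ⟩
          4 * (s * s)          ≤⟨ *-monoʳ-≤ 4 (proj₁ (proj₂ sqrt)) ⟩
          4 * (2 * d)          ≡⟨ sym (*-assoc 4 2 d) ⟩
          8 * d                ∎
          where
          open ≤-Reasoning
          s : ℕ
          s = proj₁ sqrt
          L≤2s : L ≤ s + s
          L≤2s = +-monoˡ-≤ s (0<sqrt s (proj₂ (proj₂ sqrt)))
          e : ∀ s → (s + s) * (s + s) ≡ 4 * (s * s)
          e = solve-∀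

        p≤q : p ≤ q
        p≤q = ≤-trans (m≤m+n p (p + (p + (p + 0)))) (<⇒≤ 4p<q)

        n≤d² : n ≤ d * d
        n≤d² = ^-cancelˡ-≤ q 0<q (begin
          n ^ q           ≤⟨ hyp ⟩
          d ^ (p + q)     ≤⟨ ^-monoʳ-≤ d (+-monoˡ-≤ q p≤q) ⟩
          d ^ (q + q)     ≡⟨ ^-distribˡ-+-* d q q ⟩
          d ^ q * d ^ q   ≡⟨ sym (^-distribʳ-* q d d) ⟩
          (d * d) ^ q     ∎)
          where open ≤-Reasoning

        big : 2 * (n * suc d * 2) < 2 ^ lam
        big = begin-strict
          2 * (n * suc d * 2)                    ≡⟨ e₁ n (suc d) ⟩
          4 * (n * suc d)                        ≤⟨ *-monoʳ-≤ 4 (*-mono-≤ n≤d² (+-monoˡ-≤ d 0<d)) ⟩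
          4 * (d * d * (d + d))                  ≡⟨ e₂ d ⟩
          8 * (d * d * d)                        <⟨ *-monoʳ-< 8 (*-mono-< (*-mono-< d< d<) d<) ⟩
          8 * (2 ^ suc μ * 2 ^ suc μ * 2 ^ suc μ) ≡⟨ e₃ (2 ^ suc μ) ⟩
          (2 ^ (2 + μ)) ^ 3                      ≡⟨ ^-*-assoc 2 (2 + μ) 3 ⟩
          2 ^ ((2 + μ) * 3)                      ≡⟨ cong (2 ^_) (*-comm (2 + μ) 3) ⟩
          2 ^ lam                                ∎
          where
          open ≤-Reasoning
          d< : d < 2 ^ suc μ
          d< = proj₂ (proj₂ log)
          e₁ : ∀ n m → 2 * (n * m * 2) ≡ 4 * (n * m)
          e₁ = solve-∀
          e₂ : ∀ d → 4 * (d * d * (d + d)) ≡ 8 * (d * d * d)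
          e₂ = solve-∀
          e₃ : ∀ x → 8 * (x * x * x) ≡ (2 * x) * ((2 * x) * ((2 * x) * 1))
          e₃ = solve-∀

        -- The maximum with 1 makes the additive 27 a constant factor even when `κ` is 0.
        κ⁺ : ℕ
        κ⁺ = κ ⊔ 1

        κ^q≤d^p : κ ^ q ≤ d ^ p
        κ^q≤d^p = *-cancelʳ-≤ _ _ (d ^ q) {{m^n≢0 d q}} (begin
          κ ^ q * d ^ q   ≡⟨ sym (^-distribʳ-* q κ d) ⟩
          (κ * d) ^ q     ≤⟨ ^-monoˡ-≤ q κd≤n ⟩
          n ^ q           ≤⟨ hyp ⟩
          d ^ (p + q)     ≡⟨ ^-distribˡ-+-* d p q ⟩
          d ^ p * d ^ q   ∎)
          where open ≤-Reasoning

        κ⁺^q≤d^p : κ⁺ ^ q ≤ d ^ p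
        κ⁺^q≤d^p with ⊔-sel κ 1
        ... | inj₁ e = subst (λ x → x ^ q ≤ d ^ p) (sym e) κ^q≤d^p
        ... | inj₂ e = subst (λ x → x ^ q ≤ d ^ p) (sym e)
                         (≤-trans (≤-reflexive (^-zeroˡ q)) (m^n>0 d p))

        k≤28κ⁺ : κ + 27 ≤ 28 * κ⁺
        k≤28κ⁺ = +-mono-≤ (m≤m⊔n κ 1) (*-monoʳ-≤ 27 (m≤n⊔m κ 1))

        B : ℕ
        B = A * ((2 + μ) * (2 + μ))

        -- In q-th powers, `B` contributes less than 2^μ ≤ d and κ⁺⁴ at most d^(4p). The product is
        -- below d^(1 + 4p), and 1 + 4p ≤ q.
        Bκ⁴<d : B * (κ⁺ ^ 4) < d
        Bκ⁴<d with B * (κ⁺ ^ 4) <? d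
        ... | yes lt = lt
        ... | no ¬lt = ⊥-elim (<⇒≱ powers< (^-monoˡ-≤ q (≮⇒≥ ¬lt)))
          where
          open ≤-Reasoning
          powers< : (B * κ⁺ ^ 4) ^ q < d ^ q
          powers< = begin-strict
            (B * κ⁺ ^ 4) ^ q        ≡⟨ ^-distribʳ-* q B (κ⁺ ^ 4) ⟩
            B ^ q * (κ⁺ ^ 4) ^ q    ≡⟨ cong (B ^ q *_) (trans (^-*-assoc κ⁺ 4 q) (trans (cong (κ⁺ ^_) (*-comm 4 q)) (sym (^-*-assoc κ⁺ q 4)))) ⟩
            B ^ q * (κ⁺ ^ q) ^ 4    ≤⟨ *-monoʳ-≤ (B ^ q) (^-monoˡ-≤ 4 κ⁺^q≤d^p) ⟩
            B ^ q * (d ^ p) ^ 4     <⟨ *-monoˡ-< ((d ^ p) ^ 4) {{m^n≢0 (d ^ p) 4 {{m^n≢0 d p}}}} (growth μ μ₀≤μ) ⟩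
            2 ^ μ * (d ^ p) ^ 4     ≤⟨ *-monoˡ-≤ ((d ^ p) ^ 4) (proj₁ (proj₂ log)) ⟩
            d * (d ^ p) ^ 4         ≡⟨ cong (d *_) (trans (^-*-assoc d p 4) (cong (d ^_) (*-comm p 4))) ⟩
            d ^ suc (4 * p)         ≤⟨ ^-monoʳ-≤ d 4p<q ⟩
            d ^ q                   ∎

        small : C * ((κ + 27) * (κ + 27)) * (L * lam + 1) < d
        small = ≤-<-trans ≤AL (square-cancel-< AL²<d²)
          where
          open ≤-Reasoning
          a : ℕ
          a = C₀ * (κ⁺ * κ⁺) * lam
          ≤AL : C * ((κ + 27) * (κ + 27)) * (L * lam + 1) ≤ a * L
          ≤AL = begin
            C * ((κ + 27) * (κ + 27)) * (L * lam + 1)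
              ≤⟨ *-mono-≤ (*-monoʳ-≤ C (*-mono-≤ k≤28κ⁺ k≤28κ⁺)) (+-monoʳ-≤ (L * lam) (*-mono-≤ (z<s {proj₁ sqrt}) (z<s {_}))) ⟩
            C * (28 * κ⁺ * (28 * κ⁺)) * (L * lam + L * lam)
              ≡⟨ e C 28 κ⁺ L lam ⟩
            a * L ∎
            where
            e : ∀ C x κ L l → C * (x * κ * (x * κ)) * (L * l + L * l) ≡ 2 * C * (x * x) * (κ * κ) * l * L
            e = solve-∀
          AL²<d² : a * L * (a * L) < d * d
          AL²<d² = begin-strict
            a * L * (a * L)                 ≡⟨ e₁ a L ⟩
            a * a * (L * L)                 ≤⟨ *-monoʳ-≤ (a * a) L²≤8d ⟩
            a * a * (8 * d)                 ≡⟨ e₂ C₀ κ⁺ (2 + μ) d ⟩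
            B * κ⁺ ^ 4 * d                  <⟨ *-monoˡ-< d Bκ⁴<d ⟩
            d * d                           ∎
            where
            e₁ : ∀ a L → a * L * (a * L) ≡ a * a * (L * L)
            e₁ = solve-∀
            e₂ : ∀ C κ m d → C * (κ * κ) * (3 * m) * (C * (κ * κ) * (3 * m)) * (8 * d)
                             ≡ 8 * (C * C) * 9 * (m * m) * (κ * (κ * (κ * (κ * 1)))) * d
            e₂ = solve-∀

-- Tools for the weighting

∑-strict : ∀ {n} {f g : Fin n → ℕ} → (∀ i → f i ≤ g i) → ∀ j → f j < g j → ∑ f < ∑ g
∑-strict h zero    lt = +-mono-<-≤ lt (∑-mono (λ i → h (suc i)))
∑-strict h (suc j) lt = +-mono-≤-< (h zero) (∑-strict (λ i → h (suc i)) j lt)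

∑-zero : ∀ {n} {f : Fin n → ℕ} → (∀ i → f i ≡ 0) → ∑ f ≡ 0
∑-zero {n} h = trans (∑-cong h) (trans (∑-const n 0) (*-zeroʳ n))

𝟙-∧ : ∀ a b → 𝟙 (a ∧ b) ≡ 𝟙 a * 𝟙 b
𝟙-∧ false b = refl
𝟙-∧ true  b = sym (+-identityʳ (𝟙 b))

𝟙-mono : ∀ a b → (T a → T b) → 𝟙 a ≤ 𝟙 b
𝟙-mono false b     h = z≤n
𝟙-mono true  true  h = ≤-refl
𝟙-mono true  false h = ⊥-elim (h tt)

𝟙-subadd : ∀ a b c → (T a → ¬ T b → T c) → 𝟙 a ≤ 𝟙 b + 𝟙 c
𝟙-subadd false b     c     h = z≤n
𝟙-subadd true  true  c     h = s≤s z≤n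
𝟙-subadd true  false true  h = s≤s z≤n
𝟙-subadd true  false false h = ⊥-elim (h tt (λ ()))

distribute : ∀ {n} (A : Fin n → Bool) cap x → x ≤ cap * ∑ (λ u → 𝟙 (A u)) →
  Σ (Fin n → ℕ) λ g → (∀ u → g u ≤ (if A u then cap else 0)) × ∑ g ≡ x
distribute {zero} A cap x le = (λ ()) , (λ ()) , sym (n≤0⇒n≡0 (≤-trans le (≤-reflexive (*-zeroʳ cap))))
distribute {suc n} A cap x le with A zero in eq
... | false with distribute (λ u → A (suc u)) cap x le
...   | g , g≤ , ∑g = g′ , g′≤ , ∑g
  where
  g′ : Fin (suc n) → ℕ
  g′ zero    = 0
  g′ (suc u) = g u
  g′≤ : ∀ u → g′ u ≤ (if A u then cap else 0)
  g′≤ zero    = z≤n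
  g′≤ (suc u) = g≤ u
distribute {suc n} A cap x le | true
  with distribute (λ u → A (suc u)) cap (x ∸ cap)
         (≤-trans (∸-monoˡ-≤ cap (≤-trans le (≤-reflexive (*-suc cap _)))) (≤-reflexive (m+n∸m≡n cap _)))
...   | g , g≤ , ∑g = g′ , g′≤ , trans (cong (cap ⊓ x +_) ∑g) (m⊓n+n∸m≡n cap x)
  where
  g′ : Fin (suc n) → ℕ
  g′ zero    = cap ⊓ x
  g′ (suc u) = g u
  g′≤ : ∀ u → g′ u ≤ (if A u then cap else 0)
  g′≤ zero    rewrite eq = m⊓n≤m cap x
  g′≤ (suc u) = g≤ u

∃-residue : ∀ a m t → t < m → .{{_ : NonZero m}} → Σ ℕ λ x → x < m × (a + x) % m ≡ t
∃-residue a m t t<m = x , m%n<n y m , (begin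
  (a + y % m) % m             ≡⟨ %-distribˡ-+ a (y % m) m ⟩
  (a % m + y % m % m) % m     ≡⟨ cong (λ w → (a % m + w) % m) (m%n%n≡m%n y m) ⟩
  (a % m + y % m) % m         ≡⟨ sym (%-distribˡ-+ a y m) ⟩
  (a + y) % m                 ≡⟨ cong (_% m) (sym (+-assoc a t (m ∸ a % m))) ⟩
  (a + t + (m ∸ a % m)) % m   ≡⟨ cong (λ w → (w + t + (m ∸ a % m)) % m) (m≡m%n+[m/n]*n a m) ⟩
  (a % m + a / m * m + t + (m ∸ a % m)) % m  ≡⟨ cong (_% m) (e (a % m) (a / m * m) t (m ∸ a % m)) ⟩
  (a % m + (m ∸ a % m) + t + a / m * m) % m  ≡⟨ [m+kn]%n≡m%n _ (a / m) m ⟩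
  (a % m + (m ∸ a % m) + t) % m              ≡⟨ cong (λ w → (w + t) % m) (m+[n∸m]≡n (<⇒≤ (m%n<n a m))) ⟩
  (m + t) % m                                ≡⟨ cong (_% m) (+-comm m t) ⟩
  (t + m) % m                                ≡⟨ [m+n]%n≡m%n t m ⟩
  t % m                                      ≡⟨ m<n⇒m%n≡m t<m ⟩
  t                                          ∎)
  where
  open ≡-Reasoning
  y x : ℕ
  y = t + (m ∸ a % m)
  x = y % m
  e : ∀ p q t r → p + q + t + r ≡ p + r + t + q
  e = solve-∀

-- Each row x replaces the bits of its columns by new ones; the entry is 1 + new - old.
-- So columns telescope to their degree plus the final bit, while the choice of the new
-- bits gives the row sum any residue modulo Z.
toggle : ∀ {m n} (N : Fin m → Fin n → Bool) (Z : ℕ) → .{{_ : NonZero Z}} → (pre τ : Fin m → ℕ) →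
  (β : Fin n → ℕ) → (∀ p → β p ≤ 1) →
  Σ (Fin m → Fin n → ℕ) λ t → Σ (Fin n → ℕ) λ β′ →
    (∀ p → β′ p ≤ 1) ×
    (∀ x p → t x p ≤ (if N x p then 2 else 0)) ×
    (∀ p → ∑ (λ x → t x p) + β p ≡ ∑ (λ x → 𝟙 (N x p)) + β′ p) ×
    (∀ x → Z ≤ suc (∑ (λ p → 𝟙 (N x p))) → τ x < Z → (pre x + ∑ (t x)) % Z ≡ τ x)
toggle {zero} N Z pre τ β β≤1 = (λ ()) , β , β≤1 , (λ ()) , (λ p → refl) , (λ ())
toggle {suc m} {n} N Z pre τ β β≤1 =
  let (t , β′ , β′≤1 , t≤ , cols , rows) =
        toggle (λ x → N (suc x)) Z (λ x → pre (suc x)) (λ x → τ (suc x)) β₁ β₁≤1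
      t′ : Fin (suc m) → Fin n → ℕ
      t′ = λ { zero → t₀ ; (suc x) → t x }
  in t′ , β′ , β′≤1
   , (λ { zero → t₀≤ ; (suc x) → t≤ x })
   , (λ p → trans (e₁ (t₀ p) (∑ (λ x → t x p)) (β p))
              (trans (cong (∑ (λ x → t x p) +_) (t₀β p))
              (trans (e₂ (∑ (λ x → t x p)) (𝟙 (A p)) (β₁ p))
              (trans (cong (𝟙 (A p) +_) (cols p)) (sym (+-assoc (𝟙 (A p)) _ _))))))
   , (λ { zero → row₀ ; (suc x) → rows x })
  where
  A : Fin n → Bool
  A = N zero
  -- If all new bits of this row were 0, its entries would add up to `δ ∸ o`; each new bit 1 adds 1.
  δ o : ℕ
  δ = ∑ (λ p → 𝟙 (A p))
  o = ∑ (λ p → 𝟙 (A p) * β p)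
  o≤δ : o ≤ δ
  o≤δ = ∑-mono (λ p → ≤-trans (*-monoʳ-≤ (𝟙 (A p)) (β≤1 p)) (≤-reflexive (*-identityʳ _)))
  -- The `suc δ` possible numbers of new bits 1 are consecutive, so they meet every residue once
  -- `Z ≤ suc δ`. Rows for which nothing is promised get the default 0, so that the recursion can
  -- run over all rows.
  amount : Σ ℕ λ y → y ≤ 1 * δ × (Z ≤ suc δ → τ zero < Z → (pre zero + (δ ∸ o) + y) % Z ≡ τ zero)
  amount with Z ≤? suc δ | τ zero <? Z
  ... | no ¬p | _     = 0 , z≤n , λ p _ → ⊥-elim (¬p p)
  ... | yes _ | no ¬p = 0 , z≤n , λ _ p → ⊥-elim (¬p p)
  ... | yes p | yes q with ∃-residue (pre zero + (δ ∸ o)) Z (τ zero) q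
  ...   | y , y<Z , eq = y , ≤-trans (≤-pred (≤-trans y<Z p)) (m≤m+n δ 0) , λ _ _ → eq
  y : ℕ
  y = proj₁ amount
  new : Σ (Fin n → ℕ) λ g → (∀ u → g u ≤ (if A u then 1 else 0)) × ∑ g ≡ y
  new = distribute A 1 y (proj₁ (proj₂ amount))
  ν : Fin n → ℕ
  ν = proj₁ new
  β₁ t₀ : Fin n → ℕ
  β₁ p = if A p then ν p else β p
  t₀ p = if A p then suc (ν p) ∸ β p else 0
  β₁≤1 : ∀ p → β₁ p ≤ 1
  β₁≤1 p with A p | proj₁ (proj₂ new) p
  ... | true  | ν≤1 = ν≤1
  ... | false | _   = β≤1 p
  t₀≤ : ∀ p → t₀ p ≤ (if A p then 2 else 0)
  t₀≤ p with A p | proj₁ (proj₂ new) p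
  ... | true  | ν≤1 = ≤-trans (m∸n≤m _ (β p)) (s≤s ν≤1)
  ... | false | _   = z≤n
  t₀β : ∀ p → t₀ p + β p ≡ 𝟙 (A p) + β₁ p
  t₀β p with A p
  ... | true  = m∸n+n≡m (≤-trans (β≤1 p) (s≤s z≤n))
  ... | false = refl
  t₀Aβ : ∀ p → t₀ p + 𝟙 (A p) * β p ≡ 𝟙 (A p) + ν p
  t₀Aβ p with A p | proj₁ (proj₂ new) p
  ... | true  | _   = trans (cong (suc (ν p) ∸ β p +_) (*-identityˡ (β p))) (m∸n+n≡m (≤-trans (β≤1 p) (s≤s z≤n)))
  ... | false | ν≤0 = sym (n≤0⇒n≡0 ν≤0)
  ∑t₀ : ∑ t₀ ≡ (δ ∸ o) + y
  ∑t₀ = begin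
    ∑ t₀                ≡⟨ sym (m+n∸n≡m (∑ t₀) o) ⟩
    (∑ t₀ + o) ∸ o      ≡⟨ cong (_∸ o) (sym (∑-distrib-+ t₀ _)) ⟩
    ∑ (λ p → t₀ p + 𝟙 (A p) * β p) ∸ o ≡⟨ cong (_∸ o) (trans (∑-cong t₀Aβ) (∑-distrib-+ _ ν)) ⟩
    (δ + ∑ ν) ∸ o       ≡⟨ cong (λ w → (δ + w) ∸ o) (proj₂ (proj₂ new)) ⟩
    (δ + y) ∸ o         ≡⟨ cong (_∸ o) (+-comm δ y) ⟩
    (y + δ) ∸ o         ≡⟨ +-∸-assoc y o≤δ ⟩
    y + (δ ∸ o)         ≡⟨ +-comm y _ ⟩
    (δ ∸ o) + y         ∎
    where open ≡-Reasoning
  row₀ : Z ≤ suc δ → τ zero < Z → (pre zero + ∑ t₀) % Z ≡ τ zero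
  row₀ p q = trans (cong (_% Z) (trans (cong (pre zero +_) ∑t₀) (sym (+-assoc (pre zero) _ y))))
                   (proj₂ (proj₂ amount) p q)
  e₁ : ∀ a b c → a + b + c ≡ b + (a + c)
  e₁ = solve-∀
  e₂ : ∀ a b c → a + (b + c) ≡ b + (a + c)
  e₂ = solve-∀

-- By Abel summation it suffices to compare the tails.
module _ {n m} (α : Fin n → ℕ) (x : Fin n → ℕ) (β : Fin m → ℕ) (y : Fin m → ℕ) (D : ℕ)
         (φ : ℕ → ℕ) (φ-mono : ∀ t → φ t ≤ φ (suc t))
         (total : ∑ α ≤ ∑ β + D)
         (tails : ∀ t → ∑ (λ u → α u * 𝟙 (t <ᵇ x u)) ≤ ∑ (λ i → β i * 𝟙 (t <ᵇ y i)) + D) where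
  private
    Δ : ℕ → ℕ
    Δ t = φ (suc t) ∸ φ t

    φ-step : ∀ t x → φ (x ⊓ suc t) ≡ φ (x ⊓ t) + Δ t * 𝟙 (t <ᵇ x)
    φ-step t x with t <ᵇ x in eq
    ... | true rewrite m≥n⇒m⊓n≡n (<ᵇ⇒< t x (subst T (sym eq) tt))
                     | m≥n⇒m⊓n≡n (<⇒≤ (<ᵇ⇒< t x (subst T (sym eq) tt)))
                     | *-identityʳ (Δ t) = sym (m+[n∸m]≡n (φ-mono t))
    ... | false with ≮⇒≥ (λ t<x → subst T eq (<⇒<ᵇ {t} {x} t<x))
    ...   | x≤t rewrite m≤n⇒m⊓n≡m x≤t | m≤n⇒m⊓n≡m (m≤n⇒m≤1+n x≤t) | *-zeroʳ (Δ t) = sym (+-identityʳ _)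

    ∑-step : ∀ {l} (γ z : Fin l → ℕ) t → ∑ (λ i → γ i * φ (z i ⊓ suc t))
             ≡ ∑ (λ i → γ i * φ (z i ⊓ t)) + Δ t * ∑ (λ i → γ i * 𝟙 (t <ᵇ z i))
    ∑-step γ z t = begin
      ∑ (λ i → γ i * φ (z i ⊓ suc t))
        ≡⟨ ∑-cong (λ i → trans (cong (γ i *_) (φ-step t (z i))) (e (γ i) (φ (z i ⊓ t)) (Δ t) (𝟙 (t <ᵇ z i)))) ⟩
      ∑ (λ i → γ i * φ (z i ⊓ t) + Δ t * (γ i * 𝟙 (t <ᵇ z i)))
        ≡⟨ ∑-distrib-+ (λ i → γ i * φ (z i ⊓ t)) _ ⟩
      ∑ (λ i → γ i * φ (z i ⊓ t)) + ∑ (λ i → Δ t * (γ i * 𝟙 (t <ᵇ z i)))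
        ≡⟨ cong (∑ (λ i → γ i * φ (z i ⊓ t)) +_) (∑-distribˡ-* (Δ t) (λ i → γ i * 𝟙 (t <ᵇ z i))) ⟩
      ∑ (λ i → γ i * φ (z i ⊓ t)) + Δ t * ∑ (λ i → γ i * 𝟙 (t <ᵇ z i)) ∎
      where
      open ≡-Reasoning
      e : ∀ a b c d → a * (b + c * d) ≡ a * b + c * (a * d)
      e = solve-∀

    -- Raising the truncation from `t` to `suc t` adds `Δ t` times the tail above `t`. Each step
    -- costs `Δ t * D`, and these errors telescope to `φ t * D`.
    truncated : ∀ t → ∑ (λ u → α u * φ (x u ⊓ t)) ≤ ∑ (λ i → β i * φ (y i ⊓ t)) + φ t * D
    truncated zero = begin
      ∑ (λ u → α u * φ (x u ⊓ 0))  ≡⟨ at-0 α x ⟩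
      φ 0 * ∑ α                    ≤⟨ *-monoʳ-≤ (φ 0) total ⟩
      φ 0 * (∑ β + D)              ≡⟨ *-distribˡ-+ (φ 0) (∑ β) D ⟩
      φ 0 * ∑ β + φ 0 * D          ≡⟨ cong (_+ φ 0 * D) (sym (at-0 β y)) ⟩
      ∑ (λ i → β i * φ (y i ⊓ 0)) + φ 0 * D ∎
      where
      open ≤-Reasoning
      at-0 : ∀ {l} (γ z : Fin l → ℕ) → ∑ (λ i → γ i * φ (z i ⊓ 0)) ≡ φ 0 * ∑ γ
      at-0 γ z = trans (∑-cong (λ i → trans (cong (λ w → γ i * φ w) (⊓-zeroʳ (z i))) (*-comm (γ i) (φ 0))))
                       (∑-distribˡ-* (φ 0) γ)
    truncated (suc t) = begin
      ∑ (λ u → α u * φ (x u ⊓ suc t))     ≡⟨ ∑-step α x t ⟩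
      Sα + Δ t * ∑ (λ u → α u * 𝟙 (t <ᵇ x u)) ≤⟨ +-mono-≤ (truncated t) (*-monoʳ-≤ (Δ t) (tails t)) ⟩
      (Sβ + φ t * D) + Δ t * (tβ + D)     ≡⟨ e Sβ (φ t) D (Δ t) tβ ⟩
      (Sβ + Δ t * tβ) + (φ t + Δ t) * D   ≡⟨ cong₂ _+_ (sym (∑-step β y t)) (cong (_* D) (m+[n∸m]≡n (φ-mono t))) ⟩
      ∑ (λ i → β i * φ (y i ⊓ suc t)) + φ (suc t) * D ∎
      where
      open ≤-Reasoning
      Sα Sβ tβ : ℕ
      Sα = ∑ (λ u → α u * φ (x u ⊓ t))
      Sβ = ∑ (λ i → β i * φ (y i ⊓ t))
      tβ = ∑ (λ i → β i * 𝟙 (t <ᵇ y i))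
      e : ∀ s p D q r → (s + p * D) + q * (r + D) ≡ (s + q * r) + (p + q) * D
      e = solve-∀

  monotone-sum-≤ : ∀ d → (∀ u → x u ≤ d) → (∀ i → y i ≤ d) →
    ∑ (λ u → α u * φ (x u)) ≤ ∑ (λ i → β i * φ (y i)) + φ d * D
  monotone-sum-≤ d x≤d y≤d = begin
    ∑ (λ u → α u * φ (x u))        ≡⟨ ∑-cong (λ u → cong (λ w → α u * φ w) (sym (m≤n⇒m⊓n≡m (x≤d u)))) ⟩
    ∑ (λ u → α u * φ (x u ⊓ d))    ≤⟨ truncated d ⟩
    ∑ (λ i → β i * φ (y i ⊓ d)) + φ d * D
      ≡⟨ cong (_+ φ d * D) (∑-cong (λ i → cong (λ w → β i * φ w) (m≤n⇒m⊓n≡m (y≤d i)))) ⟩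
    ∑ (λ i → β i * φ (y i)) + φ d * D ∎
    where open ≤-Reasoning

-- Ranking the vertices by colour

module Rank {n : ℕ} (c : Fin n → ℕ) where
  below : ℕ → ℕ
  below t = ∑ (λ u → 𝟙 (c u <ᵇ t))

  private
    -- The lexicographic order: colour first, ties broken by the index of the vertex.
    key : Fin n → ℕ
    key u = c u * n + toℕ u

    key-mono : ∀ {u v} → c u < c v → key u < key v
    key-mono {u} {v} lt = begin-strict
      c u * n + toℕ u   <⟨ +-monoʳ-< (c u * n) (toℕ<n u) ⟩
      c u * n + n       ≡⟨ +-comm (c u * n) n ⟩
      suc (c u) * n     ≤⟨ *-monoˡ-≤ n lt ⟩
      c v * n           ≤⟨ m≤m+n _ _ ⟩
      key v             ∎
      where open ≤-Reasoning

    key<⇒c≤ : ∀ {u v} → key u < key v → c u ≤ c v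
    key<⇒c≤ {u} {v} lt with c u ≤? c v
    ... | yes p = p
    ... | no ¬p = ⊥-elim (<-asym lt (key-mono {v} {u} (≰⇒> ¬p)))

    key-injective : ∀ u v → key u ≡ key v → u ≡ v
    key-injective u v eq with <-cmp (c u) (c v)
    ... | tri< lt _ _ = ⊥-elim (<⇒≢ (key-mono lt) eq)
    ... | tri> _ _ gt = ⊥-elim (<⇒≢ (key-mono gt) (sym eq))
    ... | tri≈ _ e _  = toℕ-injective (+-cancelˡ-≡ (c u * n) _ _ (trans eq (cong (λ w → w * n + toℕ v) (sym e))))

  rank : Fin n → ℕ
  rank v = ∑ (λ u → 𝟙 (key u <ᵇ key v))

  private
    𝟙-false : ∀ {b} → ¬ T b → 𝟙 b ≡ 0
    𝟙-false {true}  f = ⊥-elim (f tt)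
    𝟙-false {false} f = refl

    𝟙-true : ∀ {b} → T b → 𝟙 b ≡ 1
    𝟙-true {true} _ = refl

    rank-mono : ∀ u v → key u < key v → rank u < rank v
    rank-mono u v lt = ∑-strict
      (λ i → 𝟙-mono (key i <ᵇ key u) _ (λ p → <⇒<ᵇ (<-trans (<ᵇ⇒< (key i) (key u) p) lt)))
      u (≤-reflexive (trans (cong suc (𝟙-false (λ p → <-irrefl refl (<ᵇ⇒< (key u) (key u) p))))
                            (sym (𝟙-true (<⇒<ᵇ lt)))))

  c<⇒rank< : ∀ u v → c u < c v → rank u < rank v
  c<⇒rank< u v lt = rank-mono u v (key-mono lt)

  rank-injective : ∀ u v → rank u ≡ rank v → u ≡ v
  rank-injective u v eq with <-cmp (key u) (key v)
  ... | tri< lt _ _ = ⊥-elim (<⇒≢ (rank-mono u v lt) eq)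
  ... | tri> _ _ gt = ⊥-elim (<⇒≢ (rank-mono v u gt) (sym eq))
  ... | tri≈ _ e _  = key-injective u v e

  below≤rank : ∀ v t → t ≤ c v → below t ≤ rank v
  below≤rank v t t≤ = ∑-mono (λ u → 𝟙-mono (c u <ᵇ t) _
    (λ p → <⇒<ᵇ (key-mono (≤-trans (<ᵇ⇒< (c u) t p) t≤))))

  rank<below : ∀ v t → c v < t → rank v < below t
  rank<below v t c<t = ∑-strict
    (λ u → 𝟙-mono (key u <ᵇ key v) _ (λ p → <⇒<ᵇ (≤-<-trans (key<⇒c≤ (<ᵇ⇒< (key u) (key v) p)) c<t)))
    v (≤-reflexive (trans (cong suc (𝟙-false (λ p → <-irrefl refl (<ᵇ⇒< (key v) (key v) p))))
                          (sym (𝟙-true (<⇒<ᵇ c<t)))))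

-- Double counting: every vertex of `A` lies in exactly `d` neighbourhoods.
∑-nbrs : ∀ {n d} (G : Graph n) → Regular G d → (A : Fin n → Bool) →
         ∑ (λ v → nbrs G v A) ≡ d * ∑ (λ u → 𝟙 (A u))
∑-nbrs {n} {d} G reg A = begin
  ∑ (λ v → ∑ (λ u → 𝟙 (adj G v u ∧ A u)))      ≡⟨ ∑-swap (λ v u → 𝟙 (adj G v u ∧ A u)) ⟩
  ∑ (λ u → ∑ (λ v → 𝟙 (adj G v u ∧ A u)))      ≡⟨ ∑-cong (λ u → ∑-cong (λ v → e u v)) ⟩
  ∑ (λ u → ∑ (λ v → 𝟙 (A u) * 𝟙 (adj G u v)))  ≡⟨ ∑-cong (λ u → ∑-distribˡ-* (𝟙 (A u)) (λ v → 𝟙 (adj G u v))) ⟩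
  ∑ (λ u → 𝟙 (A u) * deg G u)                  ≡⟨ ∑-cong (λ u → trans (cong (𝟙 (A u) *_) (reg u)) (*-comm (𝟙 (A u)) d)) ⟩
  ∑ (λ u → d * 𝟙 (A u))                        ≡⟨ ∑-distribˡ-* d (λ u → 𝟙 (A u)) ⟩
  d * ∑ (λ u → 𝟙 (A u))                        ∎
  where
  open ≡-Reasoning
  e : ∀ u v → 𝟙 (adj G v u ∧ A u) ≡ 𝟙 (A u) * 𝟙 (adj G u v)
  e u v = trans (𝟙-∧ (adj G v u) (A u))
                (trans (cong (λ b → 𝟙 b * 𝟙 (A u)) (Graph.sym G v u)) (*-comm (𝟙 (adj G u v)) (𝟙 (A u))))

-- A correction is recorded with a direction: `g v u` is what `v` places on the edge to `u` for its
-- own sake. The weighting uses `g v u + g u v`, so a vertex sees its own amounts and those it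
-- receives as separate sums.
record Transfer {n} (G : Graph n) (act A : Fin n → Bool) (cap : ℕ) (amount : Fin n → ℕ) : Set where
  field
    g     : Fin n → Fin n → ℕ
    g≤    : ∀ v u → g v u ≤ (if act v ∧ (adj G v u ∧ A u) then cap else 0)
    ∑g    : ∀ v → T (act v) → ∑ (g v) ≡ amount v

transfer : ∀ {n} (G : Graph n) (act A : Fin n → Bool) cap amount →
  (∀ v → T (act v) → amount v ≤ cap * nbrs G v A) → Transfer G act A cap amount
transfer {n} G act A cap amount ok = record
  { g = λ v → proj₁ (row v) ; g≤ = λ v → proj₁ (proj₂ (row v)) ; ∑g = λ v → proj₂ (proj₂ (row v)) }
  where
  row : ∀ v → Σ (Fin n → ℕ) λ r → (∀ u → r u ≤ (if act v ∧ (adj G v u ∧ A u) then cap else 0)) ×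
              (T (act v) → ∑ r ≡ amount v)
  row v with act v | ok v
  ... | false | _  = (λ _ → 0) , (λ _ → z≤n) , (λ ())
  ... | true  | le with distribute (λ u → adj G v u ∧ A u) cap (amount v) (le tt)
  ...   | r , r≤ , ∑r = r , r≤ , λ _ → ∑r

<⇒<ᵇ≡true : ∀ {a b} → a < b → (a <ᵇ b) ≡ true
<⇒<ᵇ≡true {a} {b} lt with a <ᵇ b | <⇒<ᵇ lt
... | true | _ = refl

≥⇒<ᵇ≡false : ∀ {a b} → b ≤ a → (a <ᵇ b) ≡ false
≥⇒<ᵇ≡false {a} {b} ge with a <ᵇ b in eq
... | false = refl
... | true  = ⊥-elim (≤⇒≯ ge (<ᵇ⇒< a b (subst T (sym eq) tt)))

¬<ᵇ⇒≥ : ∀ {a b} → ¬ T (a <ᵇ b) → b ≤ a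
¬<ᵇ⇒≥ h = ≮⇒≥ (λ lt → h (<⇒<ᵇ lt))

<ᵇ-not : ∀ t x → (t <ᵇ x) ≡ not (x <ᵇ suc t)
<ᵇ-not t       zero    = refl
<ᵇ-not zero    (suc x) = refl
<ᵇ-not (suc t) (suc x) = <ᵇ-not t x

nbrs-subadd : ∀ {n} (G : Graph n) v A B C → (∀ u → T (A u) → ¬ T (B u) → T (C u)) →
              nbrs G v A ≤ nbrs G v B + nbrs G v C
nbrs-subadd G v A B C h = begin
  nbrs G v A ≤⟨ ∑-mono (λ u → 𝟙-subadd (adj G v u ∧ A u) (adj G v u ∧ B u) (adj G v u ∧ C u) (pt u)) ⟩
  ∑ (λ u → 𝟙 (adj G v u ∧ B u) + 𝟙 (adj G v u ∧ C u)) ≡⟨ ∑-distrib-+ (λ u → 𝟙 (adj G v u ∧ B u)) _ ⟩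
  nbrs G v B + nbrs G v C ∎
  where
  open ≤-Reasoning
  pt : ∀ u → T (adj G v u ∧ A u) → ¬ T (adj G v u ∧ B u) → T (adj G v u ∧ C u)
  pt u with adj G v u
  ... | true  = h u
  ... | false = λ ()

%-cancel-close : ∀ m .{{_ : NonZero m}} r r′ → r % m ≡ r′ % m → r < r′ + m → r′ < r + m → r ≡ r′
%-cancel-close m r r′ eq lt gt = begin
  r                     ≡⟨ m≡m%n+[m/n]*n r m ⟩
  r % m + r / m * m     ≡⟨ cong₂ (λ a b → a + b * m) eq (≤-antisym (half r r′ eq lt) (half r′ r (sym eq) gt)) ⟩
  r′ % m + r′ / m * m   ≡⟨ sym (m≡m%n+[m/n]*n r′ m) ⟩
  r′                    ∎
  where
  open ≡-Reasoning
  half : ∀ r r′ → r % m ≡ r′ % m → r < r′ + m → r / m ≤ r′ / m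
  half r r′ eq lt = ≤-pred (*-cancelʳ-< m (r / m) (suc (r′ / m)) (+-cancelˡ-< (r % m) _ _
    (subst₂ _<_ (m≡m%n+[m/n]*n r m)
       (trans (cong (_+ m) (m≡m%n+[m/n]*n r′ m))
         (trans (cong (λ a → a + r′ / m * m + m) (sym eq))
           (trans (+-assoc (r % m) _ m) (cong (r % m +_) (+-comm (r′ / m * m) m))))) lt)))

divMod-unique : ∀ M .{{_ : NonZero M}} {a a′} X X′ → a < M → a′ < M →
  a + X * M ≡ a′ + X′ * M → a ≡ a′ × X ≡ X′
divMod-unique M {a} {a′} X X′ a<M a′<M eq = a≡a′ , *-cancelʳ-≡ X X′ M (+-cancelˡ-≡ a′ _ _
    (trans (cong (_+ X * M) (sym a≡a′)) eq))
  where
  a≡a′ : a ≡ a′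
  a≡a′ = trans (sym (m<n⇒m%n≡m a<M)) (trans (sym ([m+kn]%n≡m%n a X M))
    (trans (cong (_% M) eq) (trans ([m+kn]%n≡m%n a′ X′ M) (m<n⇒m%n≡m a′<M))))

-- Modulo 2 z M, the weighted degree w is ρ + 2 q M or ρ + (2 q + 1) M.
Coded : (M z w ρ q : ℕ) → Set
Coded M z w ρ q = Σ ℕ λ b → Σ ℕ λ j → b < 2 × w ≡ ρ + (b + (q + j * z) * 2) * M

coded-unique : ∀ M z .{{_ : NonZero M}} .{{_ : NonZero z}} {w ρ ρ′ q q′} →
  ρ < M → ρ′ < M → q < z → q′ < z → Coded M z w ρ q → Coded M z w ρ′ q′ → ρ ≡ ρ′ × q ≡ q′
coded-unique M z ρ< ρ′< q< q′< (b , j , b< , eq) (b′ , j′ , b′< , eq′)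
  with divMod-unique M _ _ ρ< ρ′< (trans (sym eq) eq′)
... | ρ≡ , X≡ with divMod-unique 2 _ _ b< b′< X≡
...   | _ , Y≡ = ρ≡ , proj₁ (divMod-unique z j j′ q< q′< Y≡)

module Edges {n} (G : Graph n) (act A : Fin n → Bool) (cap : ℕ) (g : Fin n → Fin n → ℕ)
         (g≤ : ∀ v u → g v u ≤ (if act v ∧ (adj G v u ∧ A u) then cap else 0)) where
  off-edge : ∀ v u → adj G v u ≡ false → g v u ≡ 0
  off-edge v u eq with act v | adj G v u | A u | g≤ v u
  ... | false | _     | _ | le = n≤0⇒n≡0 le
  ... | true  | false | _ | le = n≤0⇒n≡0 le

  out-zero : ∀ v → ¬ T (act v) → ∑ (g v) ≡ 0
  out-zero v ¬act = ∑-zero (λ u → pt u (g≤ v u))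
    where
    pt : ∀ u → g v u ≤ (if act v ∧ (adj G v u ∧ A u) then cap else 0) → g v u ≡ 0
    pt u le with act v
    ... | true  = ⊥-elim (¬act tt)
    ... | false = n≤0⇒n≡0 le

  in-zero : ∀ v → ¬ T (A v) → ∑ (λ u → g u v) ≡ 0
  in-zero v ¬A = ∑-zero (λ u → pt u (g≤ u v))
    where
    pt : ∀ u → g u v ≤ (if act u ∧ (adj G u v ∧ A v) then cap else 0) → g u v ≡ 0
    pt u le with act u | adj G u v | A v
    ... | _     | _     | true  = ⊥-elim (¬A tt)
    ... | false | _     | false = n≤0⇒n≡0 le
    ... | true  | false | false = n≤0⇒n≡0 le
    ... | true  | true  | false = n≤0⇒n≡0 le

  capped : ∀ v u → g v u ≤ (if act v ∧ A u then cap else 0)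
  capped v u with act v | adj G v u | A u | g≤ v u
  ... | false | _     | _     | le = le
  ... | true  | false | _     | le = ≤-trans le z≤n
  ... | true  | true  | _     | le = le

data Class : Set where
  B P Q R : Class

isB isP isQ isR isX : Class → Bool
isB B = true
isB _ = false
isP P = true
isP _ = false
isQ Q = true
isQ _ = false
isR R = true
isR _ = false
isX Q = true
isX R = true
isX _ = false

-- Levels and base weights

-- Colours below e form B; from e on they are cut into 14 levels of ℓ colours, and level 14 is R.
-- Since a vertex of P may gain 1 on each edge to B, the weights h jump by 2 between the levels of P.
module Levels (K ℓ e : ℕ) .{{_ : NonZero ℓ}} where

  lev : ℕ → ℕ
  lev x = ((x ∸ e) / ℓ) ⊓ 14

  -- `top` bounds the weight of an edge from a vertex outside B to B after correction. It exceeds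
  -- `h` by 1 exactly on the levels below 7, those of P. The start `K + 5` lies above the largest
  -- weight `K + 1` inside B, and level 14 gives `K + 5 + (14 + 7)`.
  h top : ℕ → ℕ
  h   x = K + 5 + (lev x + lev x ⊓ 7)
  top x = K + 5 + (lev x + suc (lev x) ⊓ 7)

  class : ℕ → Class
  class x = if x <ᵇ e then B else if lev x <ᵇ 7 then P else if lev x <ᵇ 14 then Q else R

  data View (x : ℕ) : Class → Set where
    inB : x < e → View x B
    inP : e ≤ x → lev x < 7 → View x P
    inQ : e ≤ x → 7 ≤ lev x → lev x < 14 → View x Q
    inR : e ≤ x → lev x ≡ 14 → View x R

  view : ∀ x → View x (class x)
  view x with x <? e
  ... | yes x<e rewrite <⇒<ᵇ≡true x<e = inB x<e
  ... | no  x≮e rewrite ≥⇒<ᵇ≡false (≮⇒≥ x≮e) with lev x <? 7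
  ...   | yes i<7 rewrite <⇒<ᵇ≡true i<7 = inP (≮⇒≥ x≮e) i<7
  ...   | no  i≮7 rewrite ≥⇒<ᵇ≡false (≮⇒≥ i≮7) with lev x <? 14
  ...     | yes i<14 rewrite <⇒<ᵇ≡true i<14 = inQ (≮⇒≥ x≮e) (≮⇒≥ i≮7) i<14
  ...     | no  i≮14 rewrite ≥⇒<ᵇ≡false (≮⇒≥ i≮14) =
            inR (≮⇒≥ x≮e) (≤-antisym (m⊓n≤n ((x ∸ e) / ℓ) 14) (≮⇒≥ i≮14))

  lev-mono : ∀ {x y} → x ≤ y → lev x ≤ lev y
  lev-mono x≤y = ⊓-mono-≤ (/-monoˡ-≤ ℓ (∸-monoˡ-≤ e x≤y)) (≤-refl {14})

  lev< : ∀ x i → x < e + i * ℓ → 0 < i → lev x < i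
  lev< x i x< 0<i = ≤-<-trans (m⊓n≤m _ 14) (m<n*o⇒m/o<n (≤-<-trans-∸ x i x< 0<i))
    where
    ≤-<-trans-∸ : ∀ x i → x < e + i * ℓ → 0 < i → x ∸ e < i * ℓ
    ≤-<-trans-∸ x i@(suc _) x< _ with x ≤? e
    ... | yes p rewrite m≤n⇒m∸n≡0 p = ≤-trans (>-nonZero⁻¹ ℓ) (m≤m+n ℓ _)
    ... | no ¬p = +-cancelˡ-< e _ _ (subst (_< e + i * ℓ) (sym (m+[n∸m]≡n (<⇒≤ (≰⇒> ¬p)))) x<)

  lev≥ : ∀ x i → e + i * ℓ ≤ x → i ≤ 14 → i ≤ lev x
  lev≥ x i ≤x i≤14 = ⊓-glb
    (≤-trans (≤-reflexive (sym (m*n/n≡m i ℓ)))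
      (/-monoˡ-≤ ℓ (≤-trans (≤-reflexive (sym (m+n∸m≡n e (i * ℓ)))) (∸-monoˡ-≤ e ≤x)))) i≤14

  lev-bounds : ∀ x → e ≤ x → lev x < 14 → (e + lev x * ℓ ≤ x) × (x < e + lev x * ℓ + ℓ)
  lev-bounds x e≤x i<14 = subst (λ i → (e + i * ℓ ≤ x) × (x < e + i * ℓ + ℓ)) (sym i≡)
      ( ≤-trans (+-monoʳ-≤ e (m/n*n≤m y ℓ)) (≤-reflexive (m+[n∸m]≡n e≤x))
      , subst (_< e + y / ℓ * ℓ + ℓ) (m+[n∸m]≡n e≤x)
          (subst (e + y <_) (sym (+-assoc e _ ℓ)) (+-monoʳ-< e
            (subst (_< y / ℓ * ℓ + ℓ) (sym (m≡m%n+[m/n]*n y ℓ))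
              (subst (_< y / ℓ * ℓ + ℓ) (+-comm (y / ℓ * ℓ) (y % ℓ)) (+-monoʳ-< (y / ℓ * ℓ) (m%n<n y ℓ)))))) )
    where
    y : ℕ
    y = x ∸ e
    i≡ : lev x ≡ y / ℓ
    i≡ with ⊓-sel (y / ℓ) 14
    ... | inj₁ p = p
    ... | inj₂ p = ⊥-elim (<⇒≢ i<14 p)

  h-mono : ∀ {x y} → x ≤ y → h x ≤ h y
  h-mono x≤y = +-monoʳ-≤ (K + 5) (+-mono-≤ (lev-mono x≤y) (⊓-monoˡ-≤ 7 (lev-mono x≤y)))

  h≤top : ∀ x → h x ≤ top x
  h≤top x = +-monoʳ-≤ (K + 5) (+-monoʳ-≤ (lev x) (⊓-monoˡ-≤ 7 (n≤1+n (lev x))))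

  h<top : ∀ x → lev x < 7 → suc (h x) ≤ top x
  h<top x i<7 rewrite m≤n⇒m⊓n≡m i<7 | m≤n⇒m⊓n≡m (<⇒≤ i<7) =
    ≤-reflexive (trans (sym (+-suc (K + 5) _)) (cong (K + 5 +_) (sym (+-suc (lev x) (lev x)))))

  top≤ : ∀ x → top x ≤ K + 26
  top≤ x = ≤-trans (+-monoʳ-≤ (K + 5) (+-mono-≤ (m⊓n≤n ((x ∸ e) / ℓ) 14) (m⊓n≤n (suc (lev x)) 7)))
                   (≤-reflexive (+-assoc K 5 21))

  top<h : ∀ x y → lev x < lev y → suc (top x) ≤ h y
  top<h x y lt = ≤-trans (≤-reflexive (sym (+-suc (K + 5) _)))
                         (+-monoʳ-≤ (K + 5) (+-mono-≤ lt (⊓-monoˡ-≤ 7 lt)))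

  K+5≤h : ∀ x → K + 5 ≤ h x
  K+5≤h x = m≤m+n (K + 5) _

  -- The base weight as a function of the two colours alone. For a colour in B it is monotone in the
  -- other colour, so neighbourhood sums can be compared with sums over all colours. Edges outside B
  -- start from the minimum 1, which leaves room for the corrections.
  φ : ℕ → ℕ → ℕ
  φ x y = if x <ᵇ e then (if y <ᵇ e then (if e ≤ᵇ x + y then K + 1 else 1) else h y)
                    else (if y <ᵇ e then h x else 1)

  φ-sym : ∀ x y → φ x y ≡ φ y x
  φ-sym x y with x <ᵇ e | y <ᵇ e
  ... | true  | true  = cong (λ w → if e ≤ᵇ w then K + 1 else 1) (+-comm x y)
  ... | true  | false = refl
  ... | false | true  = refl
  ... | false | false = refl

  φBB : ∀ x y → x < e → y < e → φ x y ≤ K + 1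
  φBB x y x<e y<e rewrite <⇒<ᵇ≡true x<e | <⇒<ᵇ≡true y<e with e ≤ᵇ x + y
  ... | true  = ≤-refl
  ... | false = m≤n+m 1 K

  φBS : ∀ x y → x < e → e ≤ y → φ x y ≡ h y
  φBS x y x<e e≤y rewrite <⇒<ᵇ≡true x<e | ≥⇒<ᵇ≡false e≤y = refl

  φSB : ∀ x y → e ≤ x → y < e → φ x y ≡ h x
  φSB x y e≤x y<e = trans (φ-sym x y) (φBS y x y<e e≤x)

  φSS : ∀ x y → e ≤ x → e ≤ y → φ x y ≡ 1
  φSS x y e≤x e≤y rewrite ≥⇒<ᵇ≡false e≤x | ≥⇒<ᵇ≡false e≤y = refl

  φ≥1 : ∀ x y → 1 ≤ φ x y
  φ≥1 x y with x <ᵇ e | y <ᵇ e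
  ... | true  | false = ≤-trans (m≤n+m 1 (K + 4)) (≤-trans (≤-reflexive (+-assoc K 4 1)) (K+5≤h y))
  ... | false | true  = ≤-trans (m≤n+m 1 (K + 4)) (≤-trans (≤-reflexive (+-assoc K 4 1)) (K+5≤h x))
  ... | false | false = ≤-refl
  ... | true  | true  with e ≤ᵇ x + y
  ...   | true  = m≤n+m 1 K
  ...   | false = ≤-refl

  φ-mono : ∀ x → x < e → ∀ y → φ x y ≤ φ x (suc y)
  φ-mono x x<e y with y <? e | suc y <? e
  ... | no ¬p | yes q = ⊥-elim (¬p (<⇒≤ q))
  ... | no ¬p | no ¬q rewrite φBS x y x<e (≮⇒≥ ¬p) | φBS x (suc y) x<e (≮⇒≥ ¬q) = h-mono (n≤1+n y)
  ... | yes p | no ¬q rewrite φBS x (suc y) x<e (≮⇒≥ ¬q) =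
        ≤-trans (φBB x y x<e p) (≤-trans (+-monoʳ-≤ K (s≤s z≤n)) (K+5≤h (suc y)))
  ... | yes p | yes q rewrite <⇒<ᵇ≡true x<e | <⇒<ᵇ≡true p | <⇒<ᵇ≡true q
        with e ≤ᵇ x + y in eq | e ≤ᵇ x + suc y in eq′
  ...   | false | false = ≤-refl
  ...   | false | true  = m≤n+m 1 K
  ...   | true  | true  = ≤-refl
  ...   | true  | false = ⊥-elim (subst T eq′ (≤⇒≤ᵇ (≤-trans (≤ᵇ⇒≤ e (x + y) (subst T (sym eq) tt))
                                                      (+-monoʳ-≤ x (n≤1+n y)))))

  φ≤ : ∀ x y → x < e → φ x y ≤ K + 26
  φ≤ x y x<e with y <? e
  ... | yes p = ≤-trans (φBB x y x<e p) (+-monoʳ-≤ K (s≤s z≤n))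
  ... | no ¬p rewrite φBS x y x<e (≮⇒≥ ¬p) = ≤-trans (h≤top y) (top≤ y)

  -- For x < e, exactly x of the y < e satisfy x + y ≥ e.
  ∑φ : ∀ d x → x < e → e ≤ d → ∑ {d} (λ i → φ x (toℕ i)) ≡ K * x + ∑ {d} (λ i → φ 0 (toℕ i))
  ∑φ d x x<e e≤d = trans (∑-cong {d} (λ i → split (toℕ i)))
      (trans (∑-distrib-+ {d} (λ i → K * extra (toℕ i)) _)
        (cong (_+ ∑ {d} (λ i → φ 0 (toℕ i))) (trans (∑-distribˡ-* {d} K (λ i → extra (toℕ i))) (cong (K *_) count))))
    where
    -- The indicator of e - x ≤ y < e: exactly for these partners the weight rises from 1, its value
    -- at x = 0, to `K + 1`.
    extra : ℕ → ℕ
    extra y = 𝟙 (y <ᵇ e) ∸ 𝟙 (y <ᵇ e ∸ x)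
    split : ∀ y → φ x y ≡ K * extra y + φ 0 y
    split y with y <? e
    ... | no ¬p rewrite φBS x y x<e (≮⇒≥ ¬p) | φBS 0 y (≤-trans (s≤s z≤n) x<e) (≮⇒≥ ¬p) | ≥⇒<ᵇ≡false (≮⇒≥ ¬p)
                      | 0∸n≡0 (𝟙 (y <ᵇ e ∸ x)) | *-zeroʳ K = refl
    ... | yes p rewrite <⇒<ᵇ≡true x<e | <⇒<ᵇ≡true (≤-trans (s≤s z≤n) x<e) | <⇒<ᵇ≡true p
          with e ≤? x + y | e ≤ᵇ y in eq₀
    ...   | _     | true = ⊥-elim (<⇒≱ p (≤ᵇ⇒≤ e y (subst T (sym eq₀) tt)))
    ...   | yes q | false with e ≤ᵇ x + y | ≤⇒≤ᵇ q
    ...     | true | _ rewrite ≥⇒<ᵇ≡false {y} {e ∸ x} (≤-trans (∸-monoˡ-≤ x q) (≤-reflexive (m+n∸m≡n x y)))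
                              | *-identityʳ K = refl
    split y | yes p | no ¬q | false with e ≤ᵇ x + y in eq
    ...     | true  = ⊥-elim (¬q (≤ᵇ⇒≤ e (x + y) (subst T (sym eq) tt)))
    ...     | false rewrite <⇒<ᵇ≡true {y} {e ∸ x} (m+n≤o⇒m≤o∸n (suc y) (subst (_< e) (+-comm x y) (≰⇒> ¬q))) | *-zeroʳ K = refl
    threshold : ∀ t → t ≤ d → ∑ {d} (λ i → 𝟙 (toℕ i <ᵇ t)) ≡ t
    threshold t t≤d = trans (∑-threshold d t 1 0 t≤d) (trans (cong (t * 1 +_) (*-zeroʳ (d ∸ t)))
                        (trans (+-identityʳ (t * 1)) (*-identityʳ t)))
    count : ∑ {d} (λ i → extra (toℕ i)) ≡ x
    count = +-cancelʳ-≡ (e ∸ x) _ _ (begin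
      ∑ {d} (λ i → extra (toℕ i)) + (e ∸ x)
        ≡⟨ cong (∑ {d} (λ i → extra (toℕ i)) +_) (sym (threshold (e ∸ x) (≤-trans (m∸n≤m e x) e≤d))) ⟩
      ∑ {d} (λ i → extra (toℕ i)) + ∑ {d} (λ i → 𝟙 (toℕ i <ᵇ e ∸ x))
        ≡⟨ sym (∑-distrib-+ {d} (λ i → extra (toℕ i)) _) ⟩
      ∑ {d} (λ i → extra (toℕ i) + 𝟙 (toℕ i <ᵇ e ∸ x))
        ≡⟨ ∑-cong {d} (λ i → m∸n+n≡m (𝟙-mono (toℕ i <ᵇ e ∸ x) (toℕ i <ᵇ e)
             (λ t → <⇒<ᵇ (≤-trans (<ᵇ⇒< (toℕ i) (e ∸ x) t) (m∸n≤m e x))))) ⟩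
      ∑ {d} (λ i → 𝟙 (toℕ i <ᵇ e))  ≡⟨ threshold e e≤d ⟩
      e                             ≡⟨ sym (m+[n∸m]≡n (<⇒≤ x<e)) ⟩
      x + (e ∸ x)                   ∎)
      where open ≡-Reasoning

-- Ranks and neighbourhood sums under an equidistributed colouring

module Counts {n d : ℕ} (G : Graph n) (reg : Regular G d) (c : Fin n → ℕ) (c<d : ∀ v → c v < d) (D : ℕ)
  (disc : ∀ v t → t ≤ d → (nbrs G v (λ u → c u <ᵇ t) ≤ t + D) × (t ≤ nbrs G v (λ u → c u <ᵇ t) + D))
  (K : ℕ) .{{_ : NonZero d}} (n≤Kd : n ≤ K * d) where

  open Rank c public

  -- Summing the local bounds over all vertices and double counting carries the discrepancy from
  -- neighbourhoods to the whole graph.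
  below-upper : ∀ t → t ≤ d → d * below t ≤ n * (t + D)
  below-upper t t≤d = begin
    d * below t                               ≡⟨ sym (∑-nbrs G reg (λ u → c u <ᵇ t)) ⟩
    ∑ (λ v → nbrs G v (λ u → c u <ᵇ t))       ≤⟨ ∑-mono (λ v → proj₁ (disc v t t≤d)) ⟩
    ∑ {n} (λ _ → t + D)                       ≡⟨ ∑-const n (t + D) ⟩
    n * (t + D)                               ∎
    where open ≤-Reasoning

  below-lower : ∀ t → t ≤ d → n * t ≤ d * below t + n * D
  below-lower t t≤d = begin
    n * t                                     ≡⟨ sym (∑-const n t) ⟩
    ∑ {n} (λ _ → t)                           ≤⟨ ∑-mono (λ v → proj₂ (disc v t t≤d)) ⟩
    ∑ (λ v → nbrs G v (λ u → c u <ᵇ t) + D)   ≡⟨ ∑-distrib-+ (λ v → nbrs G v (λ u → c u <ᵇ t)) (λ _ → D) ⟩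
    ∑ (λ v → nbrs G v (λ u → c u <ᵇ t)) + ∑ {n} (λ _ → D)
      ≡⟨ cong₂ _+_ (∑-nbrs G reg (λ u → c u <ᵇ t)) (∑-const n D) ⟩
    d * below t + n * D                       ∎
    where open ≤-Reasoning

  -- A window of `len` colours holds about n len / d ≤ K len vertices, and each of its two ends
  -- costs a further `K * D`.
  rank-close : ∀ a len → a + len ≤ d → ∀ u v → c u < a + len → a ≤ c v →
               rank u < rank v + K * (len + 2 * D)
  rank-close a len a+len≤d u v cu< a≤cv = begin-strict
    rank u                              <⟨ rank<below u (a + len) cu< ⟩
    below (a + len)                     ≤⟨ *-cancelˡ-≤ d scaled ⟩
    below a + K * (len + 2 * D)         ≤⟨ +-monoˡ-≤ _ (below≤rank v a a≤cv) ⟩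
    rank v + K * (len + 2 * D)          ∎
    where
    open ≤-Reasoning
    e₁ : ∀ n a l D → n * (a + l + D) ≡ n * a + n * (l + D)
    e₁ = solve-∀
    e₂ : ∀ x n l D → x + n * D + n * (l + D) ≡ x + n * (l + 2 * D)
    e₂ = solve-∀
    e₃ : ∀ d b K x → d * b + K * d * x ≡ d * (b + K * x)
    e₃ = solve-∀
    scaled : d * below (a + len) ≤ d * (below a + K * (len + 2 * D))
    scaled = begin
      d * below (a + len)                    ≤⟨ below-upper (a + len) a+len≤d ⟩
      n * (a + len + D)                      ≡⟨ e₁ n a len D ⟩
      n * a + n * (len + D)                  ≤⟨ +-monoˡ-≤ _ (below-lower a (≤-trans (m≤m+n a len) a+len≤d)) ⟩
      d * below a + n * D + n * (len + D)    ≡⟨ e₂ (d * below a) n len D ⟩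
      d * below a + n * (len + 2 * D)        ≤⟨ +-monoʳ-≤ (d * below a) (*-monoˡ-≤ (len + 2 * D) n≤Kd) ⟩
      d * below a + K * d * (len + 2 * D)    ≡⟨ e₃ d (below a) K (len + 2 * D) ⟩
      d * (below a + K * (len + 2 * D))      ∎

  excess : ℕ
  excess = K * d ∸ n

  n+excess : n + excess ≡ K * d
  n+excess = m+[n∸m]≡n n≤Kd

  -- The second summand tilts the ranks, which grow by n/d per colour, to the integral slope K.
  slot : Fin n → ℕ
  slot v = rank v + excess * c v / d

  slot-mono : ∀ u v → rank u < rank v → slot u < slot v
  slot-mono u v lt with c u ≤? c v
  ... | yes p = +-mono-<-≤ lt (/-monoˡ-≤ d (*-monoʳ-≤ excess p))
  ... | no ¬p = ⊥-elim (<-asym lt (c<⇒rank< v u (≰⇒> ¬p)))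

  slot-injective : ∀ u v → slot u ≡ slot v → u ≡ v
  slot-injective u v eq with <-cmp (rank u) (rank v)
  ... | tri≈ _ p _  = rank-injective u v p
  ... | tri< lt _ _ = ⊥-elim (<⇒≢ (slot-mono u v lt) eq)
  ... | tri> _ _ gt = ⊥-elim (<⇒≢ (slot-mono v u gt) (sym eq))

  slot-upper : ∀ v → slot v ≤ K * c v + K * suc D
  slot-upper v = *-cancelˡ-≤ d (begin
    d * slot v                                 ≡⟨ *-distribˡ-+ d (rank v) _ ⟩
    d * rank v + d * (excess * c v / d)        ≤⟨ +-mono-≤ (*-monoʳ-≤ d (<⇒≤ (rank<below v (suc (c v)) ≤-refl)))
                                                    (≤-trans (≤-reflexive (*-comm d _)) (m/n*n≤m (excess * c v) d)) ⟩
    d * below (suc (c v)) + excess * c v       ≤⟨ +-monoˡ-≤ _ (below-upper (suc (c v)) (c<d v)) ⟩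
    n * (suc (c v) + D) + excess * c v         ≡⟨ e₁ n (c v) D excess ⟩
    (n + excess) * c v + n * suc D             ≤⟨ +-mono-≤ (≤-reflexive (cong (_* c v) n+excess)) (*-monoˡ-≤ (suc D) n≤Kd) ⟩
    K * d * c v + K * d * suc D                ≡⟨ e₂ K d (c v) (suc D) ⟩
    d * (K * c v + K * suc D)                  ∎)
    where
    open ≤-Reasoning
    e₁ : ∀ n x D r → n * (suc x + D) + r * x ≡ (n + r) * x + n * suc D
    e₁ = solve-∀
    e₂ : ∀ K d x y → K * d * x + K * d * y ≡ d * (K * x + K * y)
    e₂ = solve-∀

  slot-lower : 1 ≤ K → ∀ v → K * c v ≤ slot v + K * suc D
  slot-lower 1≤K v = begin
    K * c v                 ≤⟨ <⇒≤ (*-cancelˡ-< d _ _ scaled) ⟩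
    1 + slot v + K * D      ≡⟨ sym (+-suc (slot v) (K * D)) ⟩
    slot v + suc (K * D)    ≤⟨ +-monoʳ-≤ (slot v) (+-monoˡ-≤ (K * D) 1≤K) ⟩
    slot v + (K + K * D)    ≡⟨ cong (slot v +_) (sym (*-suc K D)) ⟩
    slot v + K * suc D      ∎
    where
    open ≤-Reasoning
    e₁ : ∀ K d x → d * (K * x) ≡ K * d * x
    e₁ = solve-∀
    e₂ : ∀ d r D q K → d * r + K * d * D + (d + q * d) ≡ d * (suc (r + q) + K * D)
    e₂ = solve-∀
    q : ℕ
    q = excess * c v / d
    rem< : excess * c v < d + q * d
    rem< = subst (_< d + q * d) (sym (m≡m%n+[m/n]*n (excess * c v) d)) (+-monoˡ-< (q * d) (m%n<n (excess * c v) d))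
    scaled : d * (K * c v) < d * (1 + slot v + K * D)
    scaled = begin-strict
      d * (K * c v)                              ≡⟨ e₁ K d (c v) ⟩
      K * d * c v                                ≡⟨ cong (_* c v) (sym n+excess) ⟩
      (n + excess) * c v                         ≡⟨ *-distribʳ-+ (c v) n excess ⟩
      n * c v + excess * c v                     ≤⟨ +-monoˡ-≤ _ (below-lower (c v) (<⇒≤ (c<d v))) ⟩
      d * below (c v) + n * D + excess * c v     ≤⟨ +-monoˡ-≤ _ (+-mono-≤ (*-monoʳ-≤ d (below≤rank v (c v) ≤-refl)) (*-monoˡ-≤ D n≤Kd)) ⟩
      d * rank v + K * d * D + excess * c v      <⟨ +-monoʳ-< _ rem< ⟩
      d * rank v + K * d * D + (d + q * d)       ≡⟨ e₂ d (rank v) D q K ⟩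
      d * (1 + slot v + K * D)                   ∎

  tail-nbrs : ∀ v t → ∑ (λ u → 𝟙 (adj G v u) * 𝟙 (t <ᵇ c u)) ≡ nbrs G v (λ u → not (c u <ᵇ suc t))
  tail-nbrs v t = ∑-cong (λ u → trans (sym (𝟙-∧ (adj G v u) (t <ᵇ c u)))
                                      (cong (λ b → 𝟙 (adj G v u ∧ b)) (<ᵇ-not t (c u))))

  tail-colours : ∀ t → suc t ≤ d → ∑ {d} (λ i → 1 * 𝟙 (t <ᵇ toℕ i)) ≡ d ∸ suc t
  tail-colours t t<d = trans (∑-cong {d} (λ i → trans (*-identityˡ _) (trans (cong 𝟙 (<ᵇ-not t (toℕ i))) (flip (toℕ i <ᵇ suc t)))))
      (trans (∑-threshold d (suc t) 0 1 t<d) (trans (cong (_+ (d ∸ suc t) * 1) (*-zeroʳ t)) (*-identityʳ _)))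
    where
    flip : ∀ b → 𝟙 (not b) ≡ (if b then 0 else 1)
    flip true  = refl
    flip false = refl

  tails-empty : ∀ {m} (α x : Fin m → ℕ) → (∀ u → x u < d) → ∀ t → d ≤ suc t → ∑ (λ u → α u * 𝟙 (t <ᵇ x u)) ≡ 0
  tails-empty α x x<d t d≤ = ∑-zero (λ u → trans (cong (λ b → α u * 𝟙 b) (≥⇒<ᵇ≡false (≤-pred (≤-trans (x<d u) d≤)))) (*-zeroʳ (α u)))

  module _ (v : Fin n) (ψ : ℕ → ℕ) (ψ-mono : ∀ t → ψ t ≤ ψ (suc t)) where
    private
      ∑1 : ∑ {d} (λ _ → 1) ≡ d
      ∑1 = trans (∑-const d 1) (*-identityʳ d)
      ∑ψ : ∑ {d} (λ i → 1 * ψ (toℕ i)) ≡ ∑ {d} (λ i → ψ (toℕ i))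
      ∑ψ = ∑-cong {d} (λ i → *-identityˡ (ψ (toℕ i)))

      upper-tail : ∀ t → ∑ (λ u → 𝟙 (adj G v u) * 𝟙 (t <ᵇ c u)) ≤ ∑ {d} (λ i → 1 * 𝟙 (t <ᵇ toℕ i)) + D
      upper-tail t with suc t ≤? d
      ... | no ¬p = ≤-trans (≤-reflexive (tails-empty (λ u → 𝟙 (adj G v u)) c c<d t (<⇒≤ (≰⇒> ¬p)))) z≤n
      ... | yes p = begin
        ∑ (λ u → 𝟙 (adj G v u) * 𝟙 (t <ᵇ c u))  ≡⟨ tail-nbrs v t ⟩
        b                                       ≤⟨ +-cancelˡ-≤ a b _ (begin
          a + b                 ≡⟨ trans (nbrs-split G v _) (reg v) ⟩
          d                     ≡⟨ sym (m+[n∸m]≡n p) ⟩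
          suc t + (d ∸ suc t)   ≤⟨ +-monoˡ-≤ _ (proj₂ (disc v (suc t) p)) ⟩
          a + D + (d ∸ suc t)   ≡⟨ trans (+-assoc a D _) (cong (a +_) (+-comm D _)) ⟩
          a + (d ∸ suc t + D)   ∎) ⟩
        d ∸ suc t + D                           ≡⟨ cong (_+ D) (sym (tail-colours t p)) ⟩
        ∑ {d} (λ i → 1 * 𝟙 (t <ᵇ toℕ i)) + D    ∎
        where
        open ≤-Reasoning
        a b : ℕ
        a = nbrs G v (λ u → c u <ᵇ suc t)
        b = nbrs G v (λ u → not (c u <ᵇ suc t))

      lower-tail : ∀ t → ∑ {d} (λ i → 1 * 𝟙 (t <ᵇ toℕ i)) ≤ ∑ (λ u → 𝟙 (adj G v u) * 𝟙 (t <ᵇ c u)) + D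
      lower-tail t with suc t ≤? d
      ... | no ¬p = ≤-trans (≤-reflexive (tails-empty {d} (λ _ → 1) toℕ toℕ<n t (<⇒≤ (≰⇒> ¬p)))) z≤n
      ... | yes p = begin
        ∑ {d} (λ i → 1 * 𝟙 (t <ᵇ toℕ i))            ≡⟨ tail-colours t p ⟩
        d ∸ suc t                                   ≤⟨ +-cancelˡ-≤ (suc t) _ _ (begin
          suc t + (d ∸ suc t)   ≡⟨ m+[n∸m]≡n p ⟩
          d                     ≡⟨ sym (trans (nbrs-split G v _) (reg v)) ⟩
          a + b                 ≤⟨ +-monoˡ-≤ b (proj₁ (disc v (suc t) p)) ⟩
          suc t + D + b         ≡⟨ trans (+-assoc (suc t) D b) (cong (suc t +_) (+-comm D b)) ⟩
          suc t + (b + D)       ∎) ⟩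
        b + D                                       ≡⟨ cong (_+ D) (sym (tail-nbrs v t)) ⟩
        ∑ (λ u → 𝟙 (adj G v u) * 𝟙 (t <ᵇ c u)) + D  ∎
        where
        open ≤-Reasoning
        a b : ℕ
        a = nbrs G v (λ u → c u <ᵇ suc t)
        b = nbrs G v (λ u → not (c u <ᵇ suc t))

    -- The neighbours of `v` are compared with an ideal neighbourhood containing each of the `d`
    -- colours once. Totals agree by regularity and tails differ by at most `D`, so Abel summation
    -- applies in both directions.
    nbr-sum-upper : ∑ (λ u → 𝟙 (adj G v u) * ψ (c u)) ≤ ∑ {d} (λ i → ψ (toℕ i)) + ψ d * D
    nbr-sum-upper = ≤-trans
      (monotone-sum-≤ (λ u → 𝟙 (adj G v u)) c (λ (_ : Fin d) → 1) toℕ D ψ ψ-mono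
         (≤-trans (≤-reflexive (trans (reg v) (sym ∑1))) (m≤m+n _ D)) upper-tail d (λ u → <⇒≤ (c<d u)) (λ i → <⇒≤ (toℕ<n i)))
      (≤-reflexive (cong (_+ ψ d * D) ∑ψ))

    nbr-sum-lower : ∑ {d} (λ i → ψ (toℕ i)) ≤ ∑ (λ u → 𝟙 (adj G v u) * ψ (c u)) + ψ d * D
    nbr-sum-lower = ≤-trans (≤-reflexive (sym ∑ψ))
      (monotone-sum-≤ (λ (_ : Fin d) → 1) toℕ (λ u → 𝟙 (adj G v u)) c D ψ ψ-mono
         (≤-trans (≤-reflexive (trans ∑1 (sym (reg v)))) (m≤m+n _ D)) lower-tail d (λ i → <⇒≤ (toℕ<n i)) (λ u → <⇒≤ (c<d u)))

-- The weighting

cap : (Class → Bool) → (Class → Bool) → ℕ → Class → Class → ℕ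
cap f g a x y = if f x ∧ g y then a else 0

-- `extra` follows the correction on an edge term by term, with every transfer at full capacity, so
-- its bound `lim` is a finite check on pairs of classes. The value `3 * M` is attained between P
-- and Q: `M` from P, and two units of `M` from toggling.
extra lim : ℕ → Class → Class → ℕ
extra M x y = (cap isB isP 1 x y + cap isB isP 1 y x) +
  ((cap isP isQ M x y + cap isP isQ M y x) +
  ((cap isQ isR M x y + cap isQ isR M y x) + M * (cap isX isP 2 x y + cap isX isP 2 y x)))
lim M B P = 1
lim M B _ = 0
lim M P B = 1
lim M _ B = 0
lim M _ _ = 3 * M

extra≤lim : ∀ M x y → extra M x y ≤ lim M x y
extra≤lim M = go
  where
  M*0≤ : ∀ {b} → M * 0 ≤ b
  M*0≤ = ≤-trans (≤-reflexive (*-zeroʳ M)) z≤n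
  M*2≤ : M * 2 ≤ 3 * M
  M*2≤ = ≤-trans (≤-reflexive (*-comm M 2)) (*-monoˡ-≤ M {2} {3} (s≤s (s≤s z≤n)))
  M+M*0≤ : M + M * 0 ≤ 3 * M
  M+M*0≤ = +-monoʳ-≤ M M*0≤
  M+M*2≤ : M + M * 2 ≤ 3 * M
  M+M*2≤ = ≤-reflexive (cong (M +_) (*-comm M 2))
  go : ∀ x y → extra M x y ≤ lim M x y
  go B B = M*0≤
  go B P = s≤s M*0≤
  go B Q = M*0≤
  go B R = M*0≤
  go P B = s≤s M*0≤
  go P P = M*0≤
  go P Q = ≤-trans (+-monoˡ-≤ (M * 2) (≤-reflexive (+-identityʳ M))) M+M*2≤
  go P R = M*2≤
  go Q B = M*0≤
  go Q P = M+M*2≤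
  go Q Q = M*0≤
  go Q R = ≤-trans (+-monoˡ-≤ (M * 0) (≤-reflexive (+-identityʳ M))) M+M*0≤
  go R B = M*0≤
  go R P = M*2≤
  go R Q = M+M*0≤
  go R R = M*0≤

if-𝟙 : ∀ b x → (if b then x else 0) ≡ 𝟙 b * x
if-𝟙 true  x = sym (*-identityˡ x)
if-𝟙 false x = refl

-- Roles of the inequalities: `3M≤` keeps edges outside B within range; `Kℓ≤zM` and `KD≤z` make the
-- moduli exceed the spread of ranks in a level and in R; `2z≤` and `2Y≤` provide enough neighbours
-- to absorb the corrections; `sep` keeps the edges outside B from closing the gaps between levels.
module Construction {n d : ℕ} (G : Graph n) (reg : Regular G d) (c : Fin n → ℕ) (c<d : ∀ v → c v < d) (D : ℕ)
  (disc : ∀ v t → t ≤ d → (nbrs G v (λ u → c u <ᵇ t) ≤ t + D) × (t ≤ nbrs G v (λ u → c u <ᵇ t) + D))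
  (K M ℓ z e : ℕ) {{_ : NonZero d}} {{_ : NonZero M}} {{_ : NonZero ℓ}} {{_ : NonZero z}}
  (d≡ : d ≡ e + 14 * ℓ + suc D) (1≤K : 1 ≤ K) (n≤Kd : n ≤ K * d)
  (3M≤ : 3 * M ≤ K + 3)
  (Kℓ≤zM : K * (ℓ + 2 * D) ≤ z * M)
  (KD≤z : K * (suc D + 2 * D) ≤ z)
  (2z≤ : 2 * z + 2 * D ≤ 7 * ℓ)
  (2Y≤ : 2 * (K * suc D + (K + 26) * D) + 2 * D ≤ 7 * ℓ)
  (sep : 2 * ((K + 26) * (14 * ℓ + suc D + D)) < d) where

  open Counts G reg c c<d D disc K n≤Kd
  open Levels K ℓ e

  k σ : ℕ
  k = K + 26
  σ = 14 * ℓ + suc D + D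

  C : Fin n → Class
  C v = class (c v)

  t₃≤d : e + 14 * ℓ ≤ d
  t₃≤d = ≤-trans (m≤m+n _ (suc D)) (≤-reflexive (sym d≡))

  e≤d : e ≤ d
  e≤d = ≤-trans (m≤m+n e _) t₃≤d

  t₂≤d : e + 7 * ℓ ≤ d
  t₂≤d = ≤-trans (+-monoʳ-≤ e (*-monoˡ-≤ ℓ {7} {14} (≤ᵇ⇒≤ 7 14 tt))) t₃≤d

  -- Neighbours available in each class

  isP-intro : ∀ x → e ≤ x → x < e + 7 * ℓ → T (isP (class x))
  isP-intro x e≤x x< with class x | view x
  ... | _ | inB x<e     = ⊥-elim (<⇒≱ x<e e≤x)
  ... | _ | inP _ _     = tt
  ... | _ | inQ _ 7≤ _  = ⊥-elim (<⇒≱ (lev< x 7 x< (s≤s z≤n)) 7≤)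
  ... | _ | inR _ eq    = ⊥-elim (<⇒≱ (lev< x 7 x< (s≤s z≤n)) (subst (7 ≤_) (sym eq) (≤ᵇ⇒≤ 7 14 tt)))

  isQ-intro : ∀ x → e + 7 * ℓ ≤ x → x < e + 14 * ℓ → T (isQ (class x))
  isQ-intro x ≤x x< with class x | view x
  ... | _ | inB x<e     = ⊥-elim (<⇒≱ x<e (≤-trans (m≤m+n e _) ≤x))
  ... | _ | inP _ i<7   = ⊥-elim (<⇒≱ i<7 (lev≥ x 7 ≤x (≤ᵇ⇒≤ 7 14 tt)))
  ... | _ | inQ _ _ _   = tt
  ... | _ | inR _ eq    = ⊥-elim (<⇒≢ (lev< x 14 x< (s≤s z≤n)) eq)

  isR-intro : ∀ x → e + 14 * ℓ ≤ x → T (isR (class x))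
  isR-intro x ≤x with class x | view x
  ... | _ | inB x<e      = ⊥-elim (<⇒≱ x<e (≤-trans (m≤m+n e _) ≤x))
  ... | _ | inP _ i<7    = ⊥-elim (<⇒≱ i<7 (≤-trans (≤ᵇ⇒≤ 7 14 tt) (lev≥ x 14 ≤x ≤-refl)))
  ... | _ | inQ _ _ i<14 = ⊥-elim (<⇒≱ i<14 (lev≥ x 14 ≤x ≤-refl))
  ... | _ | inR _ _      = tt

  interval : ∀ v a len → a + len ≤ d → (A : Fin n → Bool) → (∀ u → a ≤ c u → c u < a + len → T (A u)) →
             len ≤ nbrs G v A + 2 * D
  interval v a len a+len≤d A A-intro = +-cancelˡ-≤ a len _ (begin
    a + len                                      ≤⟨ proj₂ (disc v (a + len) a+len≤d) ⟩
    nbrs G v (λ u → c u <ᵇ a + len) + D          ≤⟨ +-monoˡ-≤ D (nbrs-subadd G v (λ u → c u <ᵇ a + len) (λ u → c u <ᵇ a) A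
                                                      (λ u p ¬q → A-intro u (¬<ᵇ⇒≥ ¬q) (<ᵇ⇒< (c u) _ p))) ⟩
    nbrs G v (λ u → c u <ᵇ a) + nbrs G v A + D   ≤⟨ +-monoˡ-≤ D (+-monoˡ-≤ _ (proj₁ (disc v a (≤-trans (m≤m+n a len) a+len≤d)))) ⟩
    a + D + nbrs G v A + D                       ≡⟨ e₁ a D (nbrs G v A) ⟩
    a + (nbrs G v A + 2 * D)                     ∎)
    where
    open ≤-Reasoning
    e₁ : ∀ a D x → a + D + x + D ≡ a + (x + 2 * D)
    e₁ = solve-∀

  nbrsP : ∀ v → 7 * ℓ ≤ nbrs G v (λ u → isP (C u)) + 2 * D
  nbrsP v = interval v e (7 * ℓ) t₂≤d _ (λ u → isP-intro (c u))

  t₃≡ : e + 7 * ℓ + 7 * ℓ ≡ e + 14 * ℓ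
  t₃≡ = eq e ℓ
    where
    eq : ∀ e ℓ → e + 7 * ℓ + 7 * ℓ ≡ e + 14 * ℓ
    eq = solve-∀

  nbrsQ : ∀ v → 7 * ℓ ≤ nbrs G v (λ u → isQ (C u)) + 2 * D
  nbrsQ v = interval v (e + 7 * ℓ) (7 * ℓ) (≤-trans (≤-reflexive t₃≡) t₃≤d) _
              (λ u ≤x x< → isQ-intro (c u) ≤x (subst (c u <_) t₃≡ x<))

  -- R consists of the top `suc D` colours, so only its lower threshold is subject to error. At most
  -- `D` of the expected `suc D` neighbours are lost, and one remains.
  nbrsR : ∀ v → 1 ≤ nbrs G v (λ u → isR (C u))
  nbrsR v = +-cancelˡ-≤ (e + 14 * ℓ + D) 1 _ (begin
    e + 14 * ℓ + D + 1                       ≡⟨ trans (+-assoc (e + 14 * ℓ) D 1) (cong (e + 14 * ℓ +_) (+-comm D 1)) ⟩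
    e + 14 * ℓ + suc D                       ≡⟨ sym d≡ ⟩
    d                                        ≡⟨ sym (trans (nbrs-split G v A) (reg v)) ⟩
    nbrs G v A + nbrs G v (λ u → not (A u))  ≤⟨ +-mono-≤ (proj₁ (disc v (e + 14 * ℓ) t₃≤d))
                                                  (∑-mono (λ u → 𝟙-mono (adj G v u ∧ not (A u)) _ (pt u))) ⟩
    e + 14 * ℓ + D + nbrs G v (λ u → isR (C u)) ∎)
    where
    open ≤-Reasoning
    A : Fin n → Bool
    A u = c u <ᵇ e + 14 * ℓ
    pt : ∀ u → T (adj G v u ∧ not (A u)) → T (adj G v u ∧ isR (C u))
    pt u t with adj G v u | A u in eq
    ... | true | false = isR-intro (c u) (¬<ᵇ⇒≥ (λ p → subst T eq p))

  nbrsS : ∀ v → nbrs G v (λ u → not (c u <ᵇ e)) ≤ σ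
  nbrsS v = +-cancelˡ-≤ e _ _ (begin
    e + nS                   ≤⟨ +-monoˡ-≤ nS (proj₂ (disc v e e≤d)) ⟩
    nB + D + nS              ≡⟨ e₁ nB D nS ⟩
    nB + nS + D              ≡⟨ cong (_+ D) (trans (nbrs-split G v _) (reg v)) ⟩
    d + D                    ≡⟨ cong (_+ D) d≡ ⟩
    e + 14 * ℓ + suc D + D   ≡⟨ e₂ e (14 * ℓ) (suc D) D ⟩
    e + σ                    ∎)
    where
    open ≤-Reasoning
    nB nS : ℕ
    nB = nbrs G v (λ u → c u <ᵇ e)
    nS = nbrs G v (λ u → not (c u <ᵇ e))
    e₁ : ∀ a b c → a + b + c ≡ a + c + b
    e₁ = solve-∀
    e₂ : ∀ a b c d → a + b + c + d ≡ a + (b + c + d)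
    e₂ = solve-∀

  -- Base weighted degrees and the correction of B

  Φ : Fin n → ℕ
  Φ v = ∑ (λ u → if adj G v u then φ (c v) (c u) else 0)

  -- `H` is the ideal base sum at colour 0. `Y` adds the worst errors of the slots and of the
  -- neighbourhood sums; shifting the targets up by `Y` makes every correction of B nonnegative and
  -- at most `2 * Y`.
  H Y : ℕ
  H = ∑ {d} (λ i → φ 0 (toℕ i))
  Y = K * suc D + k * D

  target : Fin n → ℕ
  target v = H + (Y + slot v)

  Φ-𝟙 : ∀ v → Φ v ≡ ∑ (λ u → 𝟙 (adj G v u) * φ (c v) (c u))
  Φ-𝟙 v = ∑-cong (λ u → if-𝟙 (adj G v u) _)

  Φ-upper : ∀ v → c v < e → Φ v ≤ K * c v + H + k * D
  Φ-upper v x<e = begin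
    Φ v                                               ≡⟨ Φ-𝟙 v ⟩
    ∑ (λ u → 𝟙 (adj G v u) * φ (c v) (c u))           ≤⟨ nbr-sum-upper v (φ (c v)) (φ-mono (c v) x<e) ⟩
    ∑ {d} (λ i → φ (c v) (toℕ i)) + φ (c v) d * D     ≤⟨ +-mono-≤ (≤-reflexive (∑φ d (c v) x<e e≤d)) (*-monoˡ-≤ D (φ≤ (c v) d x<e)) ⟩
    K * c v + H + k * D                               ∎
    where open ≤-Reasoning

  Φ-lower : ∀ v → c v < e → K * c v + H ≤ Φ v + k * D
  Φ-lower v x<e = begin
    K * c v + H                                       ≡⟨ sym (∑φ d (c v) x<e e≤d) ⟩
    ∑ {d} (λ i → φ (c v) (toℕ i))                     ≤⟨ nbr-sum-lower v (φ (c v)) (φ-mono (c v) x<e) ⟩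
    ∑ (λ u → 𝟙 (adj G v u) * φ (c v) (c u)) + φ (c v) d * D ≤⟨ +-mono-≤ (≤-reflexive (sym (Φ-𝟙 v))) (*-monoˡ-≤ D (φ≤ (c v) d x<e)) ⟩
    Φ v + k * D                                       ∎
    where open ≤-Reasoning

  Φ≤target : ∀ v → c v < e → Φ v ≤ target v
  Φ≤target v x<e = begin
    Φ v                                   ≤⟨ Φ-upper v x<e ⟩
    K * c v + H + k * D                   ≤⟨ +-monoˡ-≤ _ (+-monoˡ-≤ H (slot-lower 1≤K v)) ⟩
    slot v + K * suc D + H + k * D        ≡⟨ e₁ (slot v) (K * suc D) H (k * D) ⟩
    target v                              ∎
    where
    open ≤-Reasoning
    e₁ : ∀ s a h b → s + a + h + b ≡ h + (a + b + s)
    e₁ = solve-∀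

  target≤ : ∀ v → c v < e → target v ≤ Φ v + 2 * Y
  target≤ v x<e = begin
    H + (Y + slot v)                      ≤⟨ +-monoʳ-≤ H (+-monoʳ-≤ Y (slot-upper v)) ⟩
    H + (Y + (K * c v + K * suc D))       ≡⟨ e₁ H Y (K * c v) (K * suc D) ⟩
    K * c v + H + (Y + K * suc D)         ≤⟨ +-monoˡ-≤ _ (Φ-lower v x<e) ⟩
    Φ v + k * D + (Y + K * suc D)         ≡⟨ e₂ (Φ v) (k * D) (K * suc D) ⟩
    Φ v + 2 * Y                           ∎
    where
    open ≤-Reasoning
    e₁ : ∀ h y a b → h + (y + (a + b)) ≡ a + h + (y + b)
    e₁ = solve-∀
    e₂ : ∀ f a b → f + a + (b + a + b) ≡ f + 2 * (b + a)
    e₂ = solve-∀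

  c<e : ∀ v → T (isB (C v)) → c v < e
  c<e v t with class (c v) | view (c v)
  ... | _ | inB x<e = x<e

  abstract
    trB : Transfer G (λ v → isB (C v)) (λ v → isP (C v)) 1 (λ v → target v ∸ Φ v)
    trB = transfer G _ _ 1 _ (λ v t → begin
      target v ∸ Φ v                       ≤⟨ m≤n+o⇒m∸n≤o (target v) (Φ v) (target≤ v (c<e v t)) ⟩
      2 * Y                                ≤⟨ +-cancelʳ-≤ (2 * D) _ _ (≤-trans 2Y≤ (nbrsP v)) ⟩
      nbrs G v (λ u → isP (C u))           ≡⟨ sym (*-identityˡ _) ⟩
      1 * nbrs G v (λ u → isP (C u))       ∎)
      where open ≤-Reasoning

  gB : Fin n → Fin n → ℕ
  gB = Transfer.g trB

  iB : Fin n → ℕ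
  iB v = ∑ (λ u → gB u v)

  -- Corrections of P, Q and R

  N : Fin n → Fin n → Bool
  N x p = isX (C x) ∧ (adj G x p ∧ isP (C p))

  degX : Fin n → ℕ
  degX p = ∑ (λ x → 𝟙 (N x p))

  instance
    nz-zM : NonZero (z * M)
    nz-zM = m*n≢0 z M
    nz-2z : NonZero (2 * z)
    nz-2z = m*n≢0 2 z
    nz-2zM : NonZero (2 * z * M)
    nz-2zM = m*n≢0 (2 * z) M

  -- The rank modulo `z * M`, written as two digits in base `M`. The upper digit is later doubled,
  -- so that one additional `M` does not disturb it.
  ρ q : Fin n → ℕ
  ρ v = rank v % (z * M) % M
  q v = rank v % (z * M) / M

  ρ<M : ∀ v → ρ v < M
  ρ<M v = m%n<n (rank v % (z * M)) M

  q<z : ∀ v → q v < z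
  q<z v = m<n*o⇒m/o<n (m%n<n (rank v) (z * M))

  code< : ∀ v → ρ v + 2 * q v * M < 2 * z * M
  code< v = begin-strict
    ρ v + 2 * q v * M       <⟨ +-monoˡ-< _ (ρ<M v) ⟩
    M + 2 * q v * M         ≤⟨ m≤n+m _ M ⟩
    M + (M + 2 * q v * M)   ≡⟨ e₁ M (q v) ⟩
    2 * suc (q v) * M       ≤⟨ *-monoˡ-≤ M (*-monoʳ-≤ 2 (q<z v)) ⟩
    2 * z * M               ∎
    where
    open ≤-Reasoning
    e₁ : ∀ M q → M + (M + 2 * q * M) ≡ 2 * suc q * M
    e₁ = solve-∀

  2z≤nbrs : ∀ {x} → 7 * ℓ ≤ x + 2 * D → 2 * z ≤ x
  2z≤nbrs le = +-cancelʳ-≤ (2 * D) _ _ (≤-trans 2z≤ le)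

  -- The toggles are chosen only later, but their columns telescope: `v` will receive `degX v` units
  -- of `M` plus one bit. Counting `M * degX v` now leaves just that bit open.
  preP : Fin n → ℕ
  preP v = Φ v + iB v + M * degX v

  abstract
    resP : ∀ v → Σ ℕ λ x → x < 2 * z * M × (preP v + x) % (2 * z * M) ≡ ρ v + 2 * q v * M
    resP v = ∃-residue (preP v) (2 * z * M) (ρ v + 2 * q v * M) (code< v)

    trP : Transfer G (λ v → isP (C v)) (λ v → isQ (C v)) M (λ v → proj₁ (resP v))
    trP = transfer G _ _ M _ (λ v _ → ≤-trans (<⇒≤ (proj₁ (proj₂ (resP v))))
            (≤-trans (≤-reflexive (*-comm (2 * z) M)) (*-monoʳ-≤ M (2z≤nbrs (nbrsQ v)))))

  gP : Fin n → Fin n → ℕ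
  gP = Transfer.g trP

  -- Toggles can be ignored here: they add multiples of `M`, and the correction towards R concerns
  -- only the residue modulo `M`. That correction is below `M`, so a single neighbour in R can carry
  -- it.
  preQ : Fin n → ℕ
  preQ v = Φ v + ∑ (λ u → gP u v)

  abstract
    resQ : ∀ v → Σ ℕ λ x → x < M × (preQ v + x) % M ≡ ρ v
    resQ v = ∃-residue (preQ v) M (ρ v) (ρ<M v)

    trQ : Transfer G (λ v → isQ (C v)) (λ v → isR (C v)) M (λ v → proj₁ (resQ v))
    trQ = transfer G _ _ M _ (λ v _ → ≤-trans (<⇒≤ (proj₁ (proj₂ (resQ v))))
            (≤-trans (≤-reflexive (sym (*-identityʳ M))) (*-monoʳ-≤ M (nbrsR v))))

  gQ : Fin n → Fin n → ℕ
  gQ = Transfer.g trQ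

  -- Even quotients set the bit of `Coded` to 0. On R the residue modulo `M` is left as it falls, so
  -- the rank is encoded in the quotient alone.
  preX τ : Fin n → ℕ
  preX v = preQ v + (∑ (gQ v) + ∑ (λ u → gQ u v))
  τ v = if isR (C v) then 2 * (rank v % z) else 2 * q v

  abstract
    toggling : Σ (Fin n → Fin n → ℕ) λ t → Σ (Fin n → ℕ) λ β′ →
      (∀ p → β′ p ≤ 1) × (∀ x p → t x p ≤ (if N x p then 2 else 0)) ×
      (∀ p → ∑ (λ x → t x p) + 0 ≡ degX p + β′ p) ×
      (∀ x → 2 * z ≤ suc (∑ (λ p → 𝟙 (N x p))) → τ x < 2 * z → (preX x / M + ∑ (t x)) % (2 * z) ≡ τ x)
    -- All bits start at 0, so a column sum exceeds `degX` by exactly the final bit.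
    toggling = toggle N (2 * z) (λ v → preX v / M) τ (λ _ → 0) (λ _ → z≤n)

  t : Fin n → Fin n → ℕ
  t = proj₁ toggling

  -- The symmetric weights and their range

  X W : Fin n → Fin n → ℕ
  X u v = (gB u v + gB v u) + ((gP u v + gP v u) + ((gQ u v + gQ v u) + M * (t u v + t v u)))
  W u v = φ (c u) (c v) + X u v

  module TB = Edges G (λ v → isB (C v)) (λ v → isP (C v)) 1 gB (Transfer.g≤ trB)
  module TP = Edges G (λ v → isP (C v)) (λ v → isQ (C v)) M gP (Transfer.g≤ trP)
  module TQ = Edges G (λ v → isQ (C v)) (λ v → isR (C v)) M gQ (Transfer.g≤ trQ)
  module TT = Edges G (λ v → isX (C v)) (λ v → isP (C v)) 2 t (proj₁ (proj₂ (proj₂ (proj₂ toggling))))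

  W-sym : ∀ u v → W u v ≡ W v u
  W-sym u v = cong₂ _+_ (φ-sym (c u) (c v)) (cong₂ _+_ (+-comm (gB u v) _) (cong₂ _+_ (+-comm (gP u v) _)
                (cong₂ _+_ (+-comm (gQ u v) _) (cong (M *_) (+-comm (t u v) _)))))

  X≤lim : ∀ u v → X u v ≤ lim M (C u) (C v)
  X≤lim u v = ≤-trans
    (+-mono-≤ (+-mono-≤ (TB.capped u v) (TB.capped v u))
      (+-mono-≤ (+-mono-≤ (TP.capped u v) (TP.capped v u))
        (+-mono-≤ (+-mono-≤ (TQ.capped u v) (TQ.capped v u))
          (*-monoʳ-≤ M (+-mono-≤ (TT.capped u v) (TT.capped v u))))))
    (extra≤lim M (C u) (C v))

  X-off : ∀ v u → adj G v u ≡ false → X v u ≡ 0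
  X-off v u eq = begin
    X v u ≡⟨ cong₂ _+_ (cong₂ _+_ (TB.off-edge v u eq) (TB.off-edge u v eq′))
              (cong₂ _+_ (cong₂ _+_ (TP.off-edge v u eq) (TP.off-edge u v eq′))
              (cong₂ _+_ (cong₂ _+_ (TQ.off-edge v u eq) (TQ.off-edge u v eq′))
              (cong (M *_) (cong₂ _+_ (TT.off-edge v u eq) (TT.off-edge u v eq′))))) ⟩
    M * 0 ≡⟨ *-zeroʳ M ⟩
    0     ∎
    where
    open ≡-Reasoning
    eq′ : adj G u v ≡ false
    eq′ = trans (Graph.sym G u v) eq

  W≤top : ∀ v u → e ≤ c v → c u < e → W v u ≤ top (c v)
  W≤top v u e≤x y<e = ≤-trans (≤-reflexive (cong (_+ X v u) (φSB (c v) (c u) e≤x y<e))) (go (X≤lim v u))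
    where
    go : X v u ≤ lim M (C v) (C u) → h (c v) + X v u ≤ top (c v)
    go le with class (c v) | view (c v) | class (c u) | view (c u)
    ... | _ | inB x<e   | _ | _       = ⊥-elim (<⇒≱ x<e e≤x)
    ... | _ | _         | _ | inP e≤y _   = ⊥-elim (<⇒≱ y<e e≤y)
    ... | _ | _         | _ | inQ e≤y _ _ = ⊥-elim (<⇒≱ y<e e≤y)
    ... | _ | _         | _ | inR e≤y _   = ⊥-elim (<⇒≱ y<e e≤y)
    ... | _ | inP _ i<7 | _ | inB _   = ≤-trans (+-monoʳ-≤ (h (c v)) le) (≤-trans (≤-reflexive (+-comm (h (c v)) 1)) (h<top (c v) i<7))
    ... | _ | inQ _ _ _ | _ | inB _   = ≤-trans (+-monoʳ-≤ (h (c v)) le) (≤-trans (≤-reflexive (+-identityʳ (h (c v)))) (h≤top (c v)))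
    ... | _ | inR _ _   | _ | inB _   = ≤-trans (+-monoʳ-≤ (h (c v)) le) (≤-trans (≤-reflexive (+-identityʳ (h (c v)))) (h≤top (c v)))

  W-BB : ∀ v u → c v < e → c u < e → W v u ≤ K + 1
  W-BB v u x<e y<e = ≤-trans (+-mono-≤ (φBB (c v) (c u) x<e y<e) (go (X≤lim v u))) (≤-reflexive (+-identityʳ (K + 1)))
    where
    go : X v u ≤ lim M (C v) (C u) → X v u ≤ 0
    go le with class (c v) | view (c v) | class (c u) | view (c u)
    ... | _ | inB _       | _ | inB _       = le
    ... | _ | inB _       | _ | inP e≤y _   = ⊥-elim (<⇒≱ y<e e≤y)
    ... | _ | inB _       | _ | inQ e≤y _ _ = ⊥-elim (<⇒≱ y<e e≤y)
    ... | _ | inB _       | _ | inR e≤y _   = ⊥-elim (<⇒≱ y<e e≤y)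
    ... | _ | inP e≤x _   | _ | _           = ⊥-elim (<⇒≱ x<e e≤x)
    ... | _ | inQ e≤x _ _ | _ | _           = ⊥-elim (<⇒≱ x<e e≤x)
    ... | _ | inR e≤x _   | _ | _           = ⊥-elim (<⇒≱ x<e e≤x)

  lim≤3M : ∀ x y → lim M x y ≤ 3 * M
  lim≤3M x y = go x y
    where
    1≤3M : 1 ≤ 3 * M
    1≤3M = >-nonZero⁻¹ (3 * M) {{m*n≢0 3 M}}
    go : ∀ x y → lim M x y ≤ 3 * M
    go B B = z≤n
    go B P = 1≤3M
    go B Q = z≤n
    go B R = z≤n
    go P B = 1≤3M
    go Q B = z≤n
    go R B = z≤n
    go P P = ≤-refl
    go P Q = ≤-refl
    go P R = ≤-refl
    go Q P = ≤-refl
    go Q Q = ≤-refl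
    go Q R = ≤-refl
    go R P = ≤-refl
    go R Q = ≤-refl
    go R R = ≤-refl

  W≤k : ∀ u v → W u v ≤ k
  W≤k u v with c u <? e | c v <? e
  ... | yes p | yes q = ≤-trans (W-BB u v p q) (+-monoʳ-≤ K (s≤s z≤n))
  ... | yes p | no ¬q = ≤-trans (≤-reflexive (W-sym u v)) (≤-trans (W≤top v u (≮⇒≥ ¬q) p) (top≤ (c v)))
  ... | no ¬p | yes q = ≤-trans (W≤top u v (≮⇒≥ ¬p) q) (top≤ (c u))
  ... | no ¬p | no ¬q = begin
    W u v         ≡⟨ cong (_+ X u v) (φSS (c u) (c v) (≮⇒≥ ¬p) (≮⇒≥ ¬q)) ⟩
    1 + X u v     ≤⟨ +-monoʳ-≤ 1 (≤-trans (X≤lim u v) (≤-trans (lim≤3M (C u) (C v)) 3M≤)) ⟩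
    1 + (K + 3)   ≡⟨ trans (+-comm 1 (K + 3)) (+-assoc K 3 1) ⟩
    K + 4         ≤⟨ +-monoʳ-≤ K (s≤s (s≤s (s≤s (s≤s z≤n)))) ⟩
    k             ∎
    where open ≤-Reasoning

  f : Weighting G k
  f = record
    { w     = W
    ; w-sym = λ u v _ → W-sym u v
    ; w-rng = λ u v _ → ≤-trans (φ≥1 (c u) (c v)) (m≤m+n _ _) , W≤k u v
    }

  -- Weighted degrees class by class

  oB oP iP oQ iQ oT iT : Fin n → ℕ
  oB v = ∑ (gB v)
  oP v = ∑ (gP v)
  iP v = ∑ (λ u → gP u v)
  oQ v = ∑ (gQ v)
  iQ v = ∑ (λ u → gQ u v)
  oT v = ∑ (t v)
  iT v = ∑ (λ u → t u v)

  ∑-pair : ∀ (g : Fin n → Fin n → ℕ) v → ∑ (λ u → g v u + g u v) ≡ ∑ (g v) + ∑ (λ u → g u v)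
  ∑-pair g v = ∑-distrib-+ (g v) (λ u → g u v)

  wdeg≡ : ∀ v → wdeg f v ≡ Φ v + ((oB v + iB v) + ((oP v + iP v) + ((oQ v + iQ v) + M * (oT v + iT v))))
  wdeg≡ v = begin
    wdeg f v                            ≡⟨ ∑-cong (λ u → pt u) ⟩
    ∑ (λ u → φ⁺ u + X v u)              ≡⟨ ∑-distrib-+ φ⁺ (X v) ⟩
    Φ v + ∑ (X v)                       ≡⟨ cong (Φ v +_) (trans (∑-distrib-+ (λ u → gB v u + gB u v) _)
        (cong₂ _+_ (∑-pair gB v) (trans (∑-distrib-+ (λ u → gP v u + gP u v) _)
        (cong₂ _+_ (∑-pair gP v) (trans (∑-distrib-+ (λ u → gQ v u + gQ u v) _)
        (cong₂ _+_ (∑-pair gQ v) (trans (∑-distribˡ-* M (λ u → t v u + t u v)) (cong (M *_) (∑-pair t v))))))))) ⟩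
    _ ∎
    where
    open ≡-Reasoning
    φ⁺ : Fin n → ℕ
    φ⁺ u = if adj G v u then φ (c v) (c u) else 0
    pt : ∀ u → (if adj G v u then W v u else 0) ≡ φ⁺ u + X v u
    pt u with adj G v u in eq
    ... | true  = refl
    ... | false = sym (X-off v u eq)

  wdeg-B : ∀ v → C v ≡ B → wdeg f v ≡ target v
  wdeg-B v eq = begin
    wdeg f v                                ≡⟨ wdeg≡ v ⟩
    Φ v + ((oB v + iB v) + ((oP v + iP v) + ((oQ v + iQ v) + M * (oT v + iT v))))
      ≡⟨ cong₂ (λ a b → Φ v + (a + b)) (cong₂ _+_ (Transfer.∑g trB v (is isB refl)) (TB.in-zero v (isn't isP refl)))
           (cong₂ _+_ (cong₂ _+_ (TP.out-zero v (isn't isP refl)) (TP.in-zero v (isn't isQ refl)))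
             (cong₂ _+_ (cong₂ _+_ (TQ.out-zero v (isn't isQ refl)) (TQ.in-zero v (isn't isR refl)))
               (cong (M *_) (cong₂ _+_ (TT.out-zero v (isn't isX refl)) (TT.in-zero v (isn't isP refl)))))) ⟩
    Φ v + ((target v ∸ Φ v + 0) + M * 0)   ≡⟨ cong (Φ v +_) (trans (cong₂ _+_ (+-identityʳ _) (*-zeroʳ M)) (+-identityʳ _)) ⟩
    Φ v + (target v ∸ Φ v)                 ≡⟨ m+[n∸m]≡n (Φ≤target v (c<e v (is isB refl))) ⟩
    target v                               ∎
    where
    open ≡-Reasoning
    is : ∀ p → p B ≡ true → T (p (C v))
    is p h = subst T (sym (trans (cong p eq) h)) tt
    isn't : ∀ p → p B ≡ false → ¬ T (p (C v))
    isn't p h x = subst T (trans (cong p eq) h) x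

  wdeg-P : ∀ v → C v ≡ P → Coded M z (wdeg f v) (ρ v) (q v)
  wdeg-P v eq = β v , j , s≤s (β≤1 v) , (begin
    wdeg f v                                ≡⟨ wdeg≡ v ⟩
    Φ v + ((oB v + iB v) + ((oP v + iP v) + ((oQ v + iQ v) + M * (oT v + iT v))))
      ≡⟨ cong₂ (λ a b → Φ v + (a + b)) (cong (_+ iB v) (TB.out-zero v (isn't isB refl)))
           (cong₂ _+_ (cong₂ _+_ (Transfer.∑g trP v (is isP refl)) (TP.in-zero v (isn't isQ refl)))
             (cong₂ _+_ (cong₂ _+_ (TQ.out-zero v (isn't isQ refl)) (TQ.in-zero v (isn't isR refl)))
               (cong (M *_) (cong₂ _+_ (TT.out-zero v (isn't isX refl)) iT≡)))) ⟩
    Φ v + (iB v + ((x + 0) + M * (degX v + β v)))     ≡⟨ e₁ (Φ v) (iB v) x M (degX v) (β v) ⟩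
    (preP v + x) + β v * M                            ≡⟨ cong (_+ β v * M) (m≡m%n+[m/n]*n (preP v + x) (2 * z * M)) ⟩
    (preP v + x) % (2 * z * M) + j * (2 * z * M) + β v * M
      ≡⟨ cong (λ a → a + j * (2 * z * M) + β v * M) (proj₂ (proj₂ (resP v))) ⟩
    ρ v + 2 * q v * M + j * (2 * z * M) + β v * M     ≡⟨ e₂ (ρ v) (q v) M j z (β v) ⟩
    ρ v + (β v + (q v + j * z) * 2) * M               ∎)
    where
    open ≡-Reasoning
    is : ∀ p → p P ≡ true → T (p (C v))
    is p h = subst T (sym (trans (cong p eq) h)) tt
    isn't : ∀ p → p P ≡ false → ¬ T (p (C v))
    isn't p h x = subst T (trans (cong p eq) h) x
    β : Fin n → ℕ
    β = proj₁ (proj₂ toggling)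
    β≤1 : ∀ v → β v ≤ 1
    β≤1 = proj₁ (proj₂ (proj₂ toggling))
    iT≡ : iT v ≡ degX v + β v
    iT≡ = trans (sym (+-identityʳ _)) (proj₁ (proj₂ (proj₂ (proj₂ (proj₂ toggling)))) v)
    x j : ℕ
    x = proj₁ (resP v)
    j = (preP v + x) / (2 * z * M)
    e₁ : ∀ f i x M g b → f + (i + ((x + 0) + M * (g + b))) ≡ (f + i + M * g + x) + b * M
    e₁ = solve-∀
    e₂ : ∀ r q M j z b → r + 2 * q * M + j * (2 * z * M) + b * M ≡ r + (b + (q + j * z) * 2) * M
    e₂ = solve-∀

  -- Only the toggles remain to be added to `preX v`. They leave its residue modulo `M` alone and
  -- bring the quotient to the prescribed residue modulo `2 * z`; `v` has the `2 * z` neighbours in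
  -- P that this takes.
  wdeg-X : ∀ v → T (isX (C v)) → ∀ a → a < z → τ v ≡ 2 * a → Coded M z (wdeg f v) (preX v % M) a
  wdeg-X v isXv a a<z τ≡ = 0 , j , s≤s z≤n , (begin
    wdeg f v                                ≡⟨ wdeg≡ v ⟩
    Φ v + ((oB v + iB v) + ((oP v + iP v) + ((oQ v + iQ v) + M * (oT v + iT v))))
      ≡⟨ cong₂ (λ a b → Φ v + (a + b)) (cong₂ _+_ (TB.out-zero v (λ p → B≠X (C v) p isXv)) (TB.in-zero v (λ p → P≠X (C v) p isXv)))
           (cong₂ _+_ (cong (_+ iP v) (TP.out-zero v (λ p → P≠X (C v) p isXv)))
             (cong (λ w → (oQ v + iQ v) + M * (oT v + w)) (TT.in-zero v (λ p → P≠X (C v) p isXv)))) ⟩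
    Φ v + (iP v + ((oQ v + iQ v) + M * (oT v + 0)))   ≡⟨ e₁ (Φ v) (iP v) (oQ v + iQ v) M (oT v) ⟩
    preX v + oT v * M                                 ≡⟨ cong (_+ oT v * M) (m≡m%n+[m/n]*n (preX v) M) ⟩
    preX v % M + preX v / M * M + oT v * M            ≡⟨ e₂ (preX v % M) (preX v / M) M (oT v) ⟩
    preX v % M + (preX v / M + oT v) * M              ≡⟨ cong (λ w → preX v % M + w * M) quotient ⟩
    preX v % M + (0 + (a + j * z) * 2) * M            ∎)
    where
    open ≡-Reasoning
    B≠X : ∀ x → T (isB x) → ¬ T (isX x)
    B≠X B _ ()
    P≠X : ∀ x → T (isP x) → ¬ T (isX x)
    P≠X P _ ()
    j : ℕ
    j = (preX v / M + oT v) / (2 * z)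
    row : ∑ (λ p → 𝟙 (N v p)) ≡ nbrs G v (λ p → isP (C p))
    row = ∑-cong (λ p → cong 𝟙 (T-∧ (isX (C v)) (adj G v p ∧ isP (C p)) isXv))
      where
      T-∧ : ∀ a b → T a → a ∧ b ≡ b
      T-∧ true b _ = refl
    2a<2z : 2 * a < 2 * z
    2a<2z = *-monoʳ-< 2 a<z
    residue : (preX v / M + oT v) % (2 * z) ≡ τ v
    residue = proj₂ (proj₂ (proj₂ (proj₂ (proj₂ toggling)))) v
      (m≤n⇒m≤1+n (≤-trans (2z≤nbrs (nbrsP v)) (≤-reflexive (sym row))))
      (subst (_< 2 * z) (sym τ≡) 2a<2z)
    quotient : preX v / M + oT v ≡ 0 + (a + j * z) * 2
    quotient = begin
      preX v / M + oT v                                      ≡⟨ m≡m%n+[m/n]*n (preX v / M + oT v) (2 * z) ⟩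
      (preX v / M + oT v) % (2 * z) + j * (2 * z)            ≡⟨ cong (_+ j * (2 * z)) (trans residue τ≡) ⟩
      2 * a + j * (2 * z)                                    ≡⟨ e₃ a j z ⟩
      0 + (a + j * z) * 2                                    ∎
      where
      e₃ : ∀ a j z → 2 * a + j * (2 * z) ≡ 0 + (a + j * z) * 2
      e₃ = solve-∀
    e₁ : ∀ f i o M x → f + (i + (o + M * (x + 0))) ≡ f + i + o + x * M
    e₁ = solve-∀
    e₂ : ∀ r a M x → r + a * M + x * M ≡ r + (a + x) * M
    e₂ = solve-∀

  wdeg-Q : ∀ v → C v ≡ Q → Coded M z (wdeg f v) (ρ v) (q v)
  wdeg-Q v eq = subst (λ r → Coded M z (wdeg f v) r (q v)) preX%M
    (wdeg-X v (subst (λ x → T (isX x)) (sym eq) tt) (q v) (q<z v) τ≡)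
    where
    τ≡ : τ v ≡ 2 * q v
    τ≡ = cong (λ x → if isR x then 2 * (rank v % z) else 2 * q v) eq
    preX%M : preX v % M ≡ ρ v
    preX%M = trans (cong (_% M) (cong (preQ v +_)
        (trans (cong₂ _+_ (Transfer.∑g trQ v (subst (λ x → T (isQ x)) (sym eq) tt))
                          (TQ.in-zero v (subst (λ x → ¬ T (isR x)) (sym eq) (λ ()))))
               (+-identityʳ _))))
      (proj₂ (proj₂ (resQ v)))

  wdeg-R : ∀ v → C v ≡ R → Coded M z (wdeg f v) (preX v % M) (rank v % z)
  wdeg-R v eq = wdeg-X v (subst (λ x → T (isX x)) (sym eq) tt) (rank v % z) (m%n<n (rank v) z)
    (cong (λ x → if isR x then 2 * (rank v % z) else 2 * q v) eq)

  -- Separation of levels and injectivity within a level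

  wdeg-upper : ∀ v U → (∀ u → c u < e → W v u ≤ U) → wdeg f v ≤ U * d + k * σ
  wdeg-upper v U W≤U = begin
    wdeg f v                                                    ≤⟨ ∑-mono pt ⟩
    ∑ (λ u → U * 𝟙 (adj G v u) + k * 𝟙 (adj G v u ∧ not (c u <ᵇ e))) ≡⟨ ∑-distrib-+ (λ u → U * 𝟙 (adj G v u)) _ ⟩
    ∑ (λ u → U * 𝟙 (adj G v u)) + ∑ (λ u → k * 𝟙 (adj G v u ∧ not (c u <ᵇ e)))
      ≡⟨ cong₂ _+_ (trans (∑-distribˡ-* U (λ u → 𝟙 (adj G v u))) (cong (U *_) (reg v)))
                   (∑-distribˡ-* k (λ u → 𝟙 (adj G v u ∧ not (c u <ᵇ e)))) ⟩
    U * d + k * nbrs G v (λ u → not (c u <ᵇ e))                 ≤⟨ +-monoʳ-≤ (U * d) (*-monoʳ-≤ k (nbrsS v)) ⟩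
    U * d + k * σ                                               ∎
    where
    open ≤-Reasoning
    pt : ∀ u → (if adj G v u then W v u else 0) ≤ U * 𝟙 (adj G v u) + k * 𝟙 (adj G v u ∧ not (c u <ᵇ e))
    pt u with adj G v u
    ... | false = z≤n
    ... | true  = split (c u <ᵇ e) (λ p → W≤U u (<ᵇ⇒< (c u) e p))
      where
      split : ∀ b → (T b → W v u ≤ U) → W v u ≤ U * 1 + k * 𝟙 (not b)
      split true  le = ≤-trans (le tt) (≤-trans (≤-reflexive (sym (*-identityʳ U))) (m≤m+n (U * 1) (k * 0)))
      split false _  = ≤-trans (W≤k v u) (≤-trans (≤-reflexive (sym (*-identityʳ k))) (m≤n+m (k * 1) (U * 1)))

  wdeg-lower : ∀ v → e ≤ c v → h (c v) * nbrs G v (λ u → c u <ᵇ e) ≤ wdeg f v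
  wdeg-lower v e≤x = ≤-trans (≤-reflexive (sym (∑-distribˡ-* (h (c v)) (λ u → 𝟙 (adj G v u ∧ (c u <ᵇ e))))))
                             (∑-mono pt)
    where
    pt : ∀ u → h (c v) * 𝟙 (adj G v u ∧ (c u <ᵇ e)) ≤ (if adj G v u then W v u else 0)
    pt u with adj G v u
    ... | false = ≤-reflexive (*-zeroʳ (h (c v)))
    ... | true  = split (c u <ᵇ e) (λ p → ≤-trans (≤-reflexive (sym (φSB (c v) (c u) e≤x (<ᵇ⇒< (c u) e p)))) (m≤m+n _ (X v u)))
      where
      split : ∀ b → (T b → h (c v) ≤ W v u) → h (c v) * 𝟙 b ≤ W v u
      split true  le = ≤-trans (≤-reflexive (*-identityʳ (h (c v)))) (le tt)
      split false _  = ≤-trans (≤-reflexive (*-zeroʳ (h (c v)))) z≤n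

  -- If every edge at a vertex went to B, a gap of 1 in the weights would give a gap of `d` in the
  -- degrees. The edges leading outside B can spoil at most `k * σ` at each of the two vertices, and
  -- `sep` says that this is less than `d`.
  separated : ∀ u v U → (∀ y → c y < e → W u y ≤ U) → e ≤ c v → suc U ≤ h (c v) → wdeg f u ≢ wdeg f v
  separated u v U W≤U e≤x U<h eq = <-irrefl refl (begin-strict
    hv * d                    ≡⟨ cong (hv *_) (sym (trans (nbrs-split G v (λ y → c y <ᵇ e)) (reg v))) ⟩
    hv * (nB + nS)            ≡⟨ *-distribˡ-+ hv nB nS ⟩
    hv * nB + hv * nS         ≤⟨ +-mono-≤ (≤-trans (wdeg-lower v e≤x) (≤-trans (≤-reflexive (sym eq)) (wdeg-upper u U W≤U)))
                                   (*-mono-≤ (≤-trans (h≤top (c v)) (top≤ (c v))) (nbrsS v)) ⟩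
    U * d + k * σ + k * σ     ≡⟨ e₁ (U * d) (k * σ) ⟩
    U * d + 2 * (k * σ)       <⟨ +-monoʳ-< (U * d) sep ⟩
    U * d + d                 ≡⟨ +-comm (U * d) d ⟩
    suc U * d                 ≤⟨ *-monoˡ-≤ d U<h ⟩
    hv * d                    ∎)
    where
    open ≤-Reasoning
    hv nB nS : ℕ
    hv = h (c v)
    nB = nbrs G v (λ y → c y <ᵇ e)
    nS = nbrs G v (λ y → not (c y <ᵇ e))
    e₁ : ∀ a b → a + b + b ≡ a + 2 * b
    e₁ = solve-∀

  same-level : ∀ u v → e ≤ c u → e ≤ c v → wdeg f u ≡ wdeg f v → lev (c u) ≡ lev (c v)
  same-level u v e≤x e≤y eq with <-cmp (lev (c u)) (lev (c v))
  ... | tri≈ _ p _  = p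
  ... | tri< lt _ _ = ⊥-elim (separated u v (top (c u)) (λ y → W≤top u y e≤x) e≤y (top<h (c u) (c v) lt) eq)
  ... | tri> _ _ gt = ⊥-elim (separated v u (top (c v)) (λ y → W≤top v y e≤y) e≤x (top<h (c v) (c u) gt) (sym eq))

  B≢S : ∀ u v → c u < e → e ≤ c v → wdeg f u ≢ wdeg f v
  B≢S u v x<e e≤y = separated u v (K + 1) (λ y → W-BB u y x<e) e≤y
    (≤-trans (≤-reflexive (trans (+-comm 1 (K + 1)) (+-assoc K 1 1)))
      (≤-trans (+-monoʳ-≤ K {2} {5} (s≤s (s≤s z≤n))) (K+5≤h (c v))))

  -- Equal codes give ranks congruent modulo `z * M`. Within one level ranks differ by less than
  -- that, so congruence becomes equality.
  coded-rank : ∀ u v → e ≤ c u → e ≤ c v → lev (c u) ≡ lev (c v) → lev (c u) < 14 →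
    Coded M z (wdeg f u) (ρ u) (q u) → Coded M z (wdeg f v) (ρ v) (q v) → wdeg f u ≡ wdeg f v → u ≡ v
  coded-rank u v e≤x e≤y lev≡ lev< cu cv eq = rank-injective u v (%-cancel-close (z * M) (rank u) (rank v) residues
                    (close u v (proj₂ bu) (proj₁ bv)) (close v u (proj₂ bv) (proj₁ bu)))
    where
    codes≡ : ρ u ≡ ρ v × q u ≡ q v
    codes≡ = coded-unique M z (ρ<M u) (ρ<M v) (q<z u) (q<z v) cu (subst (λ w → Coded M z w (ρ v) (q v)) (sym eq) cv)
    residues : rank u % (z * M) ≡ rank v % (z * M)
    residues = trans (m≡m%n+[m/n]*n (rank u % (z * M)) M)
                 (trans (cong₂ (λ a b → a + b * M) (proj₁ codes≡) (proj₂ codes≡)) (sym (m≡m%n+[m/n]*n (rank v % (z * M)) M)))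
    i a : ℕ
    i = lev (c u)
    a = e + i * ℓ
    bu : (a ≤ c u) × (c u < a + ℓ)
    bu = lev-bounds (c u) e≤x lev<
    bv : (a ≤ c v) × (c v < a + ℓ)
    bv = subst (λ i → (e + i * ℓ ≤ c v) × (c v < e + i * ℓ + ℓ)) (sym lev≡)
           (lev-bounds (c v) e≤y (subst (_< 14) lev≡ lev<))
    a+ℓ≤d : a + ℓ ≤ d
    a+ℓ≤d = begin
      e + i * ℓ + ℓ     ≡⟨ trans (+-assoc e (i * ℓ) ℓ) (cong (e +_) (+-comm (i * ℓ) ℓ)) ⟩
      e + suc i * ℓ     ≤⟨ +-monoʳ-≤ e (*-monoˡ-≤ ℓ lev<) ⟩
      e + 14 * ℓ        ≤⟨ t₃≤d ⟩
      d                 ∎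
      where open ≤-Reasoning
    close : ∀ u v → c u < a + ℓ → a ≤ c v → rank u < rank v + z * M
    close u v p q = ≤-trans (rank-close a ℓ a+ℓ≤d u v p q) (+-monoʳ-≤ (rank v) Kℓ≤zM)

  -- Only the quotients are informative here. The modulus `z` suffices because R spans merely
  -- `suc D` colours.
  R-rank : ∀ u v → C u ≡ R → C v ≡ R → lev (c u) ≡ 14 → lev (c v) ≡ 14 → wdeg f u ≡ wdeg f v → u ≡ v
  R-rank u v Cu Cv lu lv eq =
    rank-injective u v (%-cancel-close z (rank u) (rank v) (proj₂ codes≡) (close u v lv) (close v u lu))
    where
    codes≡ : preX u % M ≡ preX v % M × rank u % z ≡ rank v % z
    codes≡ = coded-unique M z (m%n<n (preX u) M) (m%n<n (preX v) M) (m%n<n (rank u) z) (m%n<n (rank v) z)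
      (wdeg-R u Cu) (subst (λ w → Coded M z w (preX v % M) (rank v % z)) (sym eq) (wdeg-R v Cv))
    close : ∀ u v → lev (c v) ≡ 14 → rank u < rank v + z
    close u v lv = ≤-trans (rank-close (e + 14 * ℓ) (suc D) (≤-reflexive (sym d≡)) u v
                              (subst (c u <_) d≡ (c<d u)) t₃≤c) (+-monoʳ-≤ (rank v) KD≤z)
      where
      t₃≤c : e + 14 * ℓ ≤ c v
      t₃≤c with e + 14 * ℓ ≤? c v
      ... | yes p = p
      ... | no ¬p = ⊥-elim (<⇒≢ (lev< (c v) 14 (≰⇒> ¬p) (s≤s z≤n)) lv)

  irregular : Irregular f
  irregular u v eq = go (C u) (C v) refl refl (view (c u)) (view (c v))
    where
    go : ∀ x y → C u ≡ x → C v ≡ y → View (c u) x → View (c v) y → u ≡ v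
    go _ _ Cu Cv (inB p) (inB q) = slot-injective u v (+-cancelˡ-≡ Y _ _ (+-cancelˡ-≡ H _ _
      (trans (sym (wdeg-B u Cu)) (trans eq (wdeg-B v Cv)))))
    go _ _ Cu Cv (inB p) (inP q _)   = ⊥-elim (B≢S u v p q eq)
    go _ _ Cu Cv (inB p) (inQ q _ _) = ⊥-elim (B≢S u v p q eq)
    go _ _ Cu Cv (inB p) (inR q _)   = ⊥-elim (B≢S u v p q eq)
    go _ _ Cu Cv (inP p _)   (inB q) = ⊥-elim (B≢S v u q p (sym eq))
    go _ _ Cu Cv (inQ p _ _) (inB q) = ⊥-elim (B≢S v u q p (sym eq))
    go _ _ Cu Cv (inR p _)   (inB q) = ⊥-elim (B≢S v u q p (sym eq))
    go _ _ Cu Cv (inP p i) (inP q j) = coded-rank u v p q (same-level u v p q eq) (≤-trans i (≤ᵇ⇒≤ 7 14 tt))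
      (wdeg-P u Cu) (wdeg-P v Cv) eq
    go _ _ Cu Cv (inP p i) (inQ q j _) = ⊥-elim (<⇒≱ i (≤-trans j (≤-reflexive (sym (same-level u v p q eq)))))
    go _ _ Cu Cv (inP p i) (inR q j) = ⊥-elim (<⇒≱ i (≤-trans (≤ᵇ⇒≤ 7 14 tt) (≤-reflexive (sym (trans (same-level u v p q eq) j)))))
    go _ _ Cu Cv (inQ p i _) (inP q j) = ⊥-elim (<⇒≱ j (≤-trans i (≤-reflexive (same-level u v p q eq))))
    go _ _ Cu Cv (inQ p _ i) (inQ q _ j) = coded-rank u v p q (same-level u v p q eq) i
      (wdeg-Q u Cu) (wdeg-Q v Cv) eq
    go _ _ Cu Cv (inQ p _ i) (inR q j) = ⊥-elim (<⇒≢ i (trans (same-level u v p q eq) j))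
    go _ _ Cu Cv (inR p i) (inP q j) = ⊥-elim (<⇒≱ j (≤-trans (≤ᵇ⇒≤ 7 14 tt) (≤-reflexive (trans (sym i) (same-level u v p q eq)))))
    go _ _ Cu Cv (inR p i) (inQ q _ j) = ⊥-elim (<⇒≢ j (trans (sym (same-level u v p q eq)) i))
    go _ _ Cu Cv (inR p i) (inR q j) = R-rank u v Cu Cv i j eq

  irregular-weighting : HasIrregularWeighting G (K + 26)
  irregular-weighting = f , irregular

-- Choice of the parameters

irregular-weighting-from-colouring : ∀ {n d} (G : Graph n) → Regular G d → (c : Fin n → ℕ) → (∀ v → c v < d) → ∀ D →
  (∀ v t → t ≤ d → (nbrs G v (λ u → c u <ᵇ t) ≤ t + D) × (t ≤ nbrs G v (λ u → c u <ᵇ t) + D)) →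
  ∀ K → 1 ≤ K → n ≤ K * d → 448 * ((K + 26) * (K + 26)) * suc D < d →
  HasIrregularWeighting G (K + 26)
irregular-weighting-from-colouring {n} {d} G reg c c<d D disc K 1≤K n≤Kd small =
  Construction.irregular-weighting G reg c c<d D disc K M ℓ z e d≡ 1≤K n≤Kd 3M≤ Kℓ≤ KD≤ 2z≤ 2Y≤ sep
  where
  open ≤-Reasoning
  k a ℓ M z e : ℕ
  k = K + 26
  a = k * suc D
  -- Since `D ≤ a`, one spare `ℓ` covers the `14 * D` that `2z≤` has beyond `6 * ℓ`.
  ℓ = 14 * a
  -- The least `M` with `K < 3 * M`. Rounding up costs at most 3, so `3 * M ≤ K + 3` still holds.
  M = suc (K / 3)
  -- With `K ≤ 3 * M`, the factor 3 makes `z * M` exceed the spread `K * (ℓ + 2 * D)` of the ranks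
  -- in a level.
  z = 3 * (ℓ + 2 * D)
  e = d ∸ (14 * ℓ + suc D)

  1≤k : 1 ≤ k
  1≤k = ≤-trans 1≤K (m≤m+n K 26)

  D<a : suc D ≤ a
  D<a = m≤n*m (suc D) k {{>-nonZero 1≤k}}

  a≤ℓ : a ≤ ℓ
  a≤ℓ = m≤n*m a 14

  σ≤ : 14 * ℓ + suc D + D ≤ 16 * ℓ
  σ≤ = begin
    14 * ℓ + suc D + D   ≤⟨ +-mono-≤ (+-monoʳ-≤ (14 * ℓ) (≤-trans D<a a≤ℓ)) (≤-trans (n≤1+n D) (≤-trans D<a a≤ℓ)) ⟩
    14 * ℓ + ℓ + ℓ       ≡⟨ eq ℓ ⟩
    16 * ℓ               ∎
    where
    eq : ∀ x → 14 * x + x + x ≡ 16 * x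
    eq = solve-∀

  -- The origin of 448 = 2 · 16 · 14: two vertices, at most `16 * ℓ` neighbours outside B at each,
  -- and `ℓ = 14 * a`.
  sep : 2 * (k * (14 * ℓ + suc D + D)) < d
  sep = begin-strict
    2 * (k * (14 * ℓ + suc D + D))        ≤⟨ *-monoʳ-≤ 2 (*-monoʳ-≤ k σ≤) ⟩
    2 * (k * (16 * (14 * (k * suc D))))   ≡⟨ eq k (suc D) ⟩
    448 * (k * k) * suc D                 <⟨ small ⟩
    d                                     ∎
    where
    eq : ∀ k D → 2 * (k * (16 * (14 * (k * D)))) ≡ 448 * (k * k) * D
    eq = solve-∀

  fits : 14 * ℓ + suc D ≤ d
  fits = begin
    14 * ℓ + suc D                     ≤⟨ m≤m+n _ D ⟩
    14 * ℓ + suc D + D                 ≤⟨ m≤n*m _ k {{>-nonZero 1≤k}} ⟩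
    k * (14 * ℓ + suc D + D)           ≤⟨ m≤n*m _ 2 ⟩
    2 * (k * (14 * ℓ + suc D + D))     ≤⟨ <⇒≤ sep ⟩
    d                                  ∎

  K≤3M : K ≤ 3 * M
  K≤3M = begin
    K                      ≡⟨ m≡m%n+[m/n]*n K 3 ⟩
    K % 3 + K / 3 * 3      ≤⟨ +-monoˡ-≤ _ (<⇒≤ (m%n<n K 3)) ⟩
    3 + K / 3 * 3          ≡⟨ *-comm M 3 ⟩
    3 * M                  ∎

  3M≤ : 3 * M ≤ K + 3
  3M≤ = begin
    3 * M             ≡⟨ *-comm 3 M ⟩
    3 + K / 3 * 3     ≤⟨ +-monoʳ-≤ 3 (m/n*n≤m K 3) ⟩
    3 + K             ≡⟨ +-comm 3 K ⟩
    K + 3             ∎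

  Kℓ≤ : K * (ℓ + 2 * D) ≤ z * M
  Kℓ≤ = begin
    K * (ℓ + 2 * D)        ≤⟨ *-monoˡ-≤ (ℓ + 2 * D) K≤3M ⟩
    3 * M * (ℓ + 2 * D)    ≡⟨ eq M (ℓ + 2 * D) ⟩
    z * M                  ∎
    where
    eq : ∀ M x → 3 * M * x ≡ 3 * x * M
    eq = solve-∀

  KD≤ : K * (suc D + 2 * D) ≤ z
  KD≤ = begin
    K * (suc D + 2 * D)            ≤⟨ *-mono-≤ (m≤m+n K 26) (+-monoʳ-≤ (suc D) (*-monoʳ-≤ 2 (n≤1+n D))) ⟩
    k * (suc D + 2 * suc D)        ≡⟨ eq k (suc D) ⟩
    3 * a                          ≤⟨ *-monoʳ-≤ 3 (≤-trans a≤ℓ (m≤m+n ℓ (2 * D))) ⟩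
    z                              ∎
    where
    eq : ∀ k D → k * (D + 2 * D) ≡ 3 * (k * D)
    eq = solve-∀

  2z≤ : 2 * z + 2 * D ≤ 7 * ℓ
  2z≤ = begin
    2 * (3 * (ℓ + 2 * D)) + 2 * D    ≡⟨ eq ℓ D ⟩
    6 * ℓ + 14 * D                   ≤⟨ +-monoʳ-≤ (6 * ℓ) (*-monoʳ-≤ 14 (≤-trans (n≤1+n D) D<a)) ⟩
    6 * ℓ + ℓ                        ≡⟨ +-comm (6 * ℓ) ℓ ⟩
    7 * ℓ                            ∎
    where
    eq : ∀ x D → 2 * (3 * (x + 2 * D)) + 2 * D ≡ 6 * x + 14 * D
    eq = solve-∀

  2Y≤ : 2 * (K * suc D + (K + 26) * D) + 2 * D ≤ 7 * ℓ
  2Y≤ = begin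
    2 * (K * suc D + k * D) + 2 * D  ≤⟨ +-mono-≤ (*-monoʳ-≤ 2 (+-mono-≤ (*-monoˡ-≤ (suc D) (m≤m+n K 26)) (*-monoʳ-≤ k (n≤1+n D))))
                                          (*-monoʳ-≤ 2 (≤-trans (n≤1+n D) D<a)) ⟩
    2 * (a + a) + 2 * a              ≡⟨ eq a ⟩
    6 * a                            ≤⟨ *-mono-≤ (≤ᵇ⇒≤ 6 7 tt) a≤ℓ ⟩
    7 * ℓ                            ∎
    where
    eq : ∀ a → 2 * (a + a) + 2 * a ≡ 6 * a
    eq = solve-∀

  d≡ : d ≡ e + 14 * ℓ + suc D
  d≡ = trans (sym (m∸n+n≡m fits)) (sym (+-assoc e (14 * ℓ) (suc D)))

  1≤ℓ : 1 ≤ ℓ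
  1≤ℓ = ≤-trans (s≤s z≤n) (≤-trans D<a a≤ℓ)

  instance
    nzd : NonZero d
    nzd = >-nonZero (≤-trans (s≤s z≤n) sep)
    nzℓ : NonZero ℓ
    nzℓ = >-nonZero 1≤ℓ
    nzz : NonZero z
    nzz = m*n≢0 3 (ℓ + 2 * D) {{_}} {{>-nonZero (≤-trans 1≤ℓ (m≤m+n ℓ (2 * D)))}}

k*d<n+28*d : ∀ n d .{{_ : NonZero d}} → (suc (n / d) + 26) * d < n + 28 * d
k*d<n+28*d n d = begin-strict
  (suc (n / d) + 26) * d  ≡⟨ cong (_* d) (sym (+-suc (n / d) 26)) ⟩
  (n / d + 27) * d        ≡⟨ *-distribʳ-+ d (n / d) 27 ⟩
  n / d * d + 27 * d      ≤⟨ +-monoˡ-≤ (27 * d) (m/n*n≤m n d) ⟩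
  n + 27 * d              <⟨ +-monoʳ-< n (*-monoˡ-< d {27} {28} ≤-refl) ⟩
  n + 28 * d              ∎
  where open ≤-Reasoning

n≤[1+n/d]*d : ∀ n d .{{_ : NonZero d}} → n ≤ suc (n / d) * d
n≤[1+n/d]*d n d = ≤-trans (≤-reflexive (m≡m%n+[m/n]*n n d)) (+-monoˡ-≤ _ (<⇒≤ (m%n<n n d)))

-- The exponent is rational, β = p/q, and the inequalities are cleared of roots and fractions. A
-- real β < 1/4 is covered by any rational between β and 1/4, as the hypothesis only weakens when β
-- grows. A weighting with some `k` below n/d + 28 bounds the least such `k`.
theorem5 : (p q : ℕ) → 0 < p → 4 * p < q →
    Σ ℕ (λ d₀ → (d : ℕ) → d₀ ≤ d → (n : ℕ) → (G : Graph n) → Regular G d →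
    n ^ q ≤ d ^ (p + q) →
    Σ ℕ (λ k → (1 ≤ k) × (k * d < n + 28 * d) × HasIrregularWeighting G k))
theorem5 p q _ 4p<q =
  let (d₀ , params) = parameters-exist p q 4p<q 448 in
  -- The successor excludes `d = 0`, so that division by `d` is available.
  suc d₀ , λ { d@(suc _) d₀<d n G reg hyp →
    let (0<d , L , lam , 2d<L² , 2m<2^lam , small) = params d (<⇒≤ d₀<d) n (n / d) (m/n*n≤m n d) hyp
        (c , disc) = equidistributed-colouring G reg 0<d L lam 2d<L² 2m<2^lam
    in suc (n / d) + 26 , s≤s z≤n , k*d<n+28*d n d ,
       irregular-weighting-from-colouring G reg (λ v → toℕ (c v)) (λ v → toℕ<n (c v)) (L * lam) disc
         (suc (n / d)) (s≤s z≤n) (n≤[1+n/d]*d n d)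
         (subst₂ (λ k D → 448 * (k * k) * D < d) (+-suc (n / d) 26) (+-comm (L * lam) 1) small) }
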